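{- There is a function $\varepsilon:\mathbb{N}_{\ge 1}\to\mathbb{R}$ with $\varepsilon(n)\to 0$ as $n\to\infty$ such that for every $n\ge 1$ and every graph $G$ on $n$ vertices, $$n^{\left(\frac12+\varepsilon(n)\right)\log_2 n}\;\le\;\pi(G)\;\le\;(n+1)2^n .$$ Furthermore, the upper bound is attained by the complete graph $K_n$ and by the empty graph $E_n$, i.e. $\pi(K_n)=\pi(E_n)=(n+1)2^n$.
   Context: Graphs are finite and simple. $k(G)$ is the number of cliques of $G$ (vertex subsets inducing a complete subgraph) and $i(G)$ is the number of independent sets of $G$; the empty set and all singletons count both as cliques and as independent sets. $\pi(G)=i(G)\,k(G)=k(\overline{G})\,k(G)$, where $\overline{G}$ is the complement of $G$. $E_n$ denotes the graph on $n$ vertices with no edges. -}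

module Defs where

open import Level using (0ℓ)
open import Data.Empty using (⊥)
open import Data.Fin using (Fin)
import Data.Fin.Properties as Fin
open import Data.Fin.Subset using (Subset; inside; outside; _∈_)
open import Data.Fin.Subset.Properties using (_∈?_)
open import Data.Integer as ℤ using (ℤ; +_; -[1+_])
import Data.Integer.Properties as ℤₚ
import Data.Integer.Solver as ℤS
open import Data.List using (List; []; _∷_; _++_; map; filter; length)
open import Data.Nat as ℕ using (ℕ; zero; suc)
import Data.Nat.Coprimality as Coprimality
import Data.Nat.Properties as ℕₚ
open import Data.Product using (∃; ∃₂; _×_; _,_; proj₁; proj₂)
open import Data.Rational
import Data.Rational.Properties as ℚₚ
open import Data.Rational.Solver using (module +-*-Solver)
import Data.Rational.Unnormalised as ℚᵘ
import Data.Rational.Unnormalised.Properties as ℚᵘₚ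
open import Data.Sum using (_⊎_; inj₁; inj₂; [_,_]′)
open import Data.Vec using ([]; _∷_)
open import Algebra.Bundles using (CommutativeRing)
open import Relation.Binary using (Rel; Decidable; tri<; tri≈; tri>; Symmetric; Irreflexive)
open import Relation.Binary.PropositionalEquality
open import Relation.Nullary using (¬_; Dec; yes; no; contradiction)
open import Relation.Nullary.Decidable using (¬?; _→-dec_)
open import Relation.Unary using (Pred)

open import Algebra.Properties.CommutativeSemiring.Exp
  (CommutativeRing.commutativeSemiring ℚₚ.+-*-commutativeRing) public
  using () renaming (_^_ to _^ℚ_)
open import Algebra.Properties.CommutativeSemiring.Exp
  (CommutativeRing.commutativeSemiring ℚₚ.+-*-commutativeRing)
  using (^-assocʳ; ^-distrib-*)

open +-*-Solver using (solve; _:+_; _:*_; _:-_; :-_; _:=_; con)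

module Order where

  module ≤R = ℚₚ.≤-Reasoning

  0<1 : 0ℚ < 1ℚ
  0<1 = ℚₚ.positive⁻¹ 1ℚ

  *-monoʳ-≤ : ∀ {r p q} → 0ℚ ≤ r → p ≤ q → p * r ≤ q * r
  *-monoʳ-≤ {r} 0≤r = ℚₚ.*-monoʳ-≤-nonNeg r {{nonNegative 0≤r}}

  *-monoˡ-≤ : ∀ {r p q} → 0ℚ ≤ r → p ≤ q → r * p ≤ r * q
  *-monoˡ-≤ {r} 0≤r = ℚₚ.*-monoˡ-≤-nonNeg r {{nonNegative 0≤r}}

  *-mono-≤ : ∀ {p q r s} → 0ℚ ≤ p → 0ℚ ≤ s → p ≤ q → r ≤ s → p * r ≤ q * s
  *-mono-≤ 0≤p 0≤s p≤q r≤s =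
    ℚₚ.≤-trans (*-monoˡ-≤ 0≤p r≤s) (*-monoʳ-≤ 0≤s p≤q)

  *-monoʳ-< : ∀ {r p q} → 0ℚ < r → p < q → p * r < q * r
  *-monoʳ-< {r} 0<r = ℚₚ.*-monoˡ-<-pos r {{positive 0<r}}

  *-nonNeg : ∀ {p q} → 0ℚ ≤ p → 0ℚ ≤ q → 0ℚ ≤ p * q
  *-nonNeg {p} {q} 0≤p 0≤q =
    subst (_≤ p * q) (ℚₚ.*-zeroˡ q) (*-monoʳ-≤ 0≤q 0≤p)

  *-pos : ∀ {p q} → 0ℚ < p → 0ℚ < q → 0ℚ < p * q
  *-pos {p} {q} 0<p 0<q =
    subst (_< p * q) (ℚₚ.*-zeroˡ q) (*-monoʳ-< 0<q 0<p)

  +-nonNeg : ∀ {p q} → 0ℚ ≤ p → 0ℚ ≤ q → 0ℚ ≤ p + q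
  +-nonNeg 0≤p 0≤q = ℚₚ.+-mono-≤ 0≤p 0≤q

  p≤p+q : ∀ {p q} → 0ℚ ≤ q → p ≤ p + q
  p≤p+q {p} {q} 0≤q = subst (_≤ p + q) (ℚₚ.+-identityʳ p) (ℚₚ.+-monoʳ-≤ p 0≤q)

  p<p+q : ∀ {p q} → 0ℚ < q → p < p + q
  p<p+q {p} {q} 0<q = subst (_< p + q) (ℚₚ.+-identityʳ p) (ℚₚ.+-monoʳ-< p 0<q)

  q≤p+q : ∀ {p q} → 0ℚ ≤ p → q ≤ p + q
  q≤p+q {p} {q} 0≤p = subst (_≤ p + q) (ℚₚ.+-identityˡ q) (ℚₚ.+-monoˡ-≤ q 0≤p)

  p+[q-p]≡q : ∀ p q → p + (q - p) ≡ q
  p+[q-p]≡q = solve 2 (λ p q → p :+ (q :- p) := q) refl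

  abstract
    p<q⇒0<q-p : ∀ {p q} → p < q → 0ℚ < q - p
    p<q⇒0<q-p {p} {q} p<q =
      subst (_< q - p) (ℚₚ.+-inverseʳ p) (ℚₚ.+-monoˡ-< (- p) p<q)

  abstract
    1/pos : ∀ {p} → 0ℚ < p → ∃ λ s → 0ℚ < s × p * s ≡ 1ℚ
    1/pos {p} 0<p =
      (1/ p) , ℚₚ.positive⁻¹ (1/ p) {{ℚₚ.1/pos⇒pos p}} , ℚₚ.*-inverseʳ p
      where
      instance
        p⁺ : Positive p
        p⁺ = positive 0<p
        p≢0 : NonZero p
        p≢0 = ℚₚ.pos⇒nonZero p

  neg-neg : ∀ p → - (- p) ≡ p
  neg-neg = solve 1 (λ p → :- (:- p) := p) refl

  p≤∣p∣ : ∀ p → p ≤ ∣ p ∣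
  p≤∣p∣ p with ℚₚ.≤-total 0ℚ p
  ... | inj₁ 0≤p = ℚₚ.≤-reflexive (sym (ℚₚ.0≤p⇒∣p∣≡p 0≤p))
  ... | inj₂ p≤0 = ℚₚ.≤-trans p≤0 (ℚₚ.0≤∣p∣ p)

  -∣p∣≤p : ∀ p → - ∣ p ∣ ≤ p
  -∣p∣≤p p = subst (- ∣ p ∣ ≤_) (neg-neg p)
    (ℚₚ.neg-antimono-≤ (subst (- p ≤_) (ℚₚ.∣-p∣≡∣p∣ p) (p≤∣p∣ (- p))))

  ∣∣≤ : ∀ {p s} → p ≤ s → - p ≤ s → ∣ p ∣ ≤ s
  ∣∣≤ {p} p≤s -p≤s with ℚₚ.∣p∣≡p∨∣p∣≡-p p
  ... | inj₁ eq = subst (_≤ _) (sym eq) p≤s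
  ... | inj₂ eq = subst (_≤ _) (sym eq) -p≤s

  between⇒∣∣≤ : ∀ {a p b} → a ≤ p → p ≤ b → ∣ p ∣ ≤ ∣ a ∣ + ∣ b ∣
  between⇒∣∣≤ {a} {p} {b} a≤p p≤b = ∣∣≤
    (ℚₚ.≤-trans p≤b (ℚₚ.≤-trans (p≤∣p∣ b) (q≤p+q (ℚₚ.0≤∣p∣ a))))
    (ℚₚ.≤-trans (ℚₚ.neg-antimono-≤ a≤p)
      (ℚₚ.≤-trans (subst (- a ≤_) (ℚₚ.∣-p∣≡∣p∣ a) (p≤∣p∣ (- a)))
        (p≤p+q (ℚₚ.0≤∣p∣ b))))

open Order

fromℕ : ℕ → ℚ
fromℕ n = + n / 1

module Embedding where

  toℚᵘ-/ : ∀ n d .{{_ : ℕ.NonZero d}} → toℚᵘ (n / d) ℚᵘ.≃ (n ℚᵘ./ d)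
  toℚᵘ-/ n (suc d) = ℚₚ.toℚᵘ-fromℚᵘ (ℚᵘ.mkℚᵘ n d)

  fromℕ-suc : ∀ n → fromℕ (suc n) ≡ 1ℚ + fromℕ n
  fromℕ-suc n = ℚₚ.toℚᵘ-injective (begin
    toℚᵘ (+ suc n / 1)               ≈⟨ toℚᵘ-/ (+ suc n) 1 ⟩
    (+ suc n ℚᵘ./ 1)                 ≈⟨ ℚᵘ.*≡* (ℤ+-lemma (+ n)) ⟩
    (+ 1 ℚᵘ./ 1) ℚᵘ.+ (+ n ℚᵘ./ 1)   ≈⟨ ℚᵘₚ.+-congʳ (+ 1 ℚᵘ./ 1) (ℚᵘₚ.≃-sym (toℚᵘ-/ (+ n) 1)) ⟩
    toℚᵘ 1ℚ ℚᵘ.+ toℚᵘ (fromℕ n)      ≈⟨ ℚᵘₚ.≃-sym (ℚₚ.toℚᵘ-homo-+ 1ℚ (fromℕ n)) ⟩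
    toℚᵘ (1ℚ + fromℕ n)              ∎)
    where
    open ℚᵘₚ.≃-Reasoning
    open ℤS.+-*-Solver using () renaming (solve to solveℤ; _:+_ to _⊕_; _:*_ to _⊗_; _:=_ to _⊜_; con to conℤ)
    ℤ+-lemma : ∀ m → (+ 1 ℤ.+ m) ℤ.* + 1 ≡ (+ 1 ℤ.* + 1 ℤ.+ m ℤ.* + 1) ℤ.* + 1
    ℤ+-lemma = solveℤ 1 (λ m → (conℤ (+ 1) ⊕ m) ⊗ conℤ (+ 1)
      ⊜ (conℤ (+ 1) ⊗ conℤ (+ 1) ⊕ m ⊗ conℤ (+ 1)) ⊗ conℤ (+ 1)) refl

  ≤fromℕ : ∀ p → ∃ λ n → p ≤ fromℕ n
  ≤fromℕ p@(mkℚ (+ n) d c) = n , ℚₚ.toℚᵘ-cancel-≤ (ℚᵘₚ.≤-trans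
    (ℚᵘ.*≤* (ℤₚ.*-monoˡ-≤-nonNeg (+ n) (ℤ.+≤+ (ℕ.s≤s ℕ.z≤n))))
    (ℚᵘₚ.≤-reflexive (ℚᵘₚ.≃-sym (toℚᵘ-/ (+ n) 1))))
  ≤fromℕ p@(mkℚ -[1+ _ ] _ _) = 0 , ℚₚ.nonPositive⁻¹ p

  -- fromℕ, sealed so that conversion checking does not unfold its gcd.
  opaque
    ι : ℕ → ℚ
    ι = fromℕ

    ι≡fromℕ : ∀ n → ι n ≡ fromℕ n
    ι≡fromℕ n = refl

    ι-zero : ι 0 ≡ 0ℚ
    ι-zero = refl

    ι-suc : ∀ n → ι (suc n) ≡ 1ℚ + ι n
    ι-suc = fromℕ-suc

    ≤ι : ∀ p → ∃ λ n → p ≤ ι n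
    ≤ι = ≤fromℕ

  0≤ι : ∀ n → 0ℚ ≤ ι n
  0≤ι zero    = ℚₚ.≤-reflexive (sym ι-zero)
  0≤ι (suc n) = subst (0ℚ ≤_) (sym (ι-suc n))
    (+-nonNeg (ℚₚ.<⇒≤ 0<1) (0≤ι n))

  1≤fromℕ : ∀ n .{{_ : ℕ.NonZero n}} → 1ℚ ≤ fromℕ n
  1≤fromℕ (suc n) = subst (1ℚ ≤_) (trans (sym (ι-suc n)) (ι≡fromℕ (suc n)))
    (p≤p+q (0≤ι n))

  0<fromℕ : ∀ n .{{_ : ℕ.NonZero n}} → 0ℚ < fromℕ n
  0<fromℕ n = ℚₚ.<-≤-trans 0<1 (1≤fromℕ n)

  abstract
    archimedean : ∀ {h} → 0ℚ < h → ∀ p → ∃ λ n → p ≤ ι n * h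
    archimedean {h} 0<h p with 1/pos 0<h
    ... | s , 0<s , hs≡1 with ≤ι (p * s)
    ...   | n , ps≤n = n , subst (_≤ ι n * h)
      (trans (solve 3 (λ p s h → (p :* s) :* h := p :* (h :* s)) refl p s h)
        (trans (cong (p *_) hs≡1) (ℚₚ.*-identityʳ p)))
      (*-monoʳ-≤ (ℚₚ.<⇒≤ 0<h) ps≤n)

open Embedding

fromℕ-nonZero : ∀ n .{{_ : ℕ.NonZero n}} → NonZero (fromℕ n)
fromℕ-nonZero n = >-nonZero (0<fromℕ n)

infixr 8 _^ℤ_ _^ᶻ_

_^ℤ_ : (p : ℚ) → .{{NonZero p}} → ℤ → ℚ
p ^ℤ (+ n)    = p ^ℚ n
p ^ℤ -[1+ n ] = (1/ p) ^ℚ suc n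

_^ᶻ_ : (n : ℕ) → .{{ℕ.NonZero n}} → ℤ → ℚ
n ^ᶻ z = _^ℤ_ (fromℕ n) {{fromℕ-nonZero n}} z

module Powers where

  ^-nonNeg : ∀ {p} n → 0ℚ ≤ p → 0ℚ ≤ p ^ℚ n
  ^-nonNeg zero    0≤p = ℚₚ.<⇒≤ 0<1
  ^-nonNeg (suc n) 0≤p = *-nonNeg 0≤p (^-nonNeg n 0≤p)

  ^-pos : ∀ {p} n → 0ℚ < p → 0ℚ < p ^ℚ n
  ^-pos zero    0<p = 0<1
  ^-pos (suc n) 0<p = *-pos 0<p (^-pos n 0<p)

  ^-mono-≤ : ∀ {p q} n → 0ℚ ≤ p → p ≤ q → p ^ℚ n ≤ q ^ℚ n
  ^-mono-≤ zero    0≤p p≤q = ℚₚ.≤-refl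
  ^-mono-≤ (suc n) 0≤p p≤q = *-mono-≤ 0≤p
    (^-nonNeg n (ℚₚ.≤-trans 0≤p p≤q)) p≤q (^-mono-≤ n 0≤p p≤q)

  ^-mono-< : ∀ {p q} n .{{_ : ℕ.NonZero n}} → 0ℚ ≤ p → p < q → p ^ℚ n < q ^ℚ n
  ^-mono-< {p} {q} (suc n) 0≤p p<q = ℚₚ.≤-<-trans
    (*-monoˡ-≤ 0≤p (^-mono-≤ n 0≤p (ℚₚ.<⇒≤ p<q)))
    (*-monoʳ-< (^-pos n (ℚₚ.≤-<-trans 0≤p p<q)) p<q)

  ^-cancel-≤ : ∀ {p q} n .{{_ : ℕ.NonZero n}} → 0ℚ ≤ q → p ^ℚ n ≤ q ^ℚ n → p ≤ q
  ^-cancel-≤ {p} {q} n 0≤q pⁿ≤qⁿ with p ≤? q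
  ... | yes p≤q = p≤q
  ... | no  p≰q = contradiction
    (ℚₚ.<-≤-trans (^-mono-< n 0≤q (ℚₚ.≰⇒> p≰q)) pⁿ≤qⁿ) (ℚₚ.<-irrefl refl)

  bernoulli : ∀ {t} → 0ℚ ≤ t → ∀ n → 1ℚ + ι n * t ≤ (1ℚ + t) ^ℚ n
  bernoulli {t} 0≤t zero = ℚₚ.≤-reflexive
    (trans (cong (λ x → 1ℚ + x) (trans (cong (_* t) ι-zero) (ℚₚ.*-zeroˡ t))) (ℚₚ.+-identityʳ 1ℚ))
  bernoulli {t} 0≤t (suc n) = begin
    1ℚ + ι (suc n) * t          ≡⟨ cong (λ x → 1ℚ + x * t) (ι-suc n) ⟩
    1ℚ + (1ℚ + N) * t               ≤⟨ p≤p+q (*-nonNeg (*-nonNeg (0≤ι n) 0≤t) 0≤t) ⟩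
    1ℚ + (1ℚ + N) * t + N * t * t   ≡⟨ solve 2 (λ N t →
      con 1ℚ :+ (con 1ℚ :+ N) :* t :+ N :* t :* t := (con 1ℚ :+ t) :* (con 1ℚ :+ N :* t)) refl N t ⟩
    (1ℚ + t) * (1ℚ + N * t)         ≤⟨ *-monoˡ-≤ (+-nonNeg (ℚₚ.<⇒≤ 0<1) 0≤t) (bernoulli 0≤t n) ⟩
    (1ℚ + t) * (1ℚ + t) ^ℚ n        ∎
    where
    open ≤R
    N = ι n

  ^-distrib : ∀ p q n → (p * q) ^ℚ n ≡ p ^ℚ n * q ^ℚ n
  ^-distrib = ^-distrib-*

  ^-assoc : ∀ p m n → (p ^ℚ m) ^ℚ n ≡ p ^ℚ (m ℕ.* n)
  ^-assoc = ^-assocʳ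

  ^-dominates′ : ∀ {t p} → 0ℚ ≤ t → 0ℚ ≤ p → ∀ c n → c ≤ ι n * t →
    c * p ^ℚ n ≤ ((1ℚ + t) * p) ^ℚ n
  ^-dominates′ {t} {p} 0≤t 0≤p c n c≤nt = subst (c * p ^ℚ n ≤_)
    (sym (^-distrib (1ℚ + t) p n))
    (*-monoʳ-≤ (^-nonNeg n 0≤p)
      (ℚₚ.≤-trans c≤nt (ℚₚ.≤-trans (q≤p+q (ℚₚ.<⇒≤ 0<1)) (bernoulli 0≤t n))))

  [1+t]p≡q : ∀ {p q s} → p * s ≡ 1ℚ → (1ℚ + (q - p) * s) * p ≡ q
  [1+t]p≡q {p} {q} {s} ps≡1 = begin
    (1ℚ + (q - p) * s) * p       ≡⟨ ℚₚ.*-distribʳ-+ p 1ℚ ((q - p) * s) ⟩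
    1ℚ * p + (q - p) * s * p     ≡⟨ cong₂ _+_ (ℚₚ.*-identityˡ p) (ℚₚ.*-assoc (q - p) s p) ⟩
    p + (q - p) * (s * p)        ≡⟨ cong (λ x → p + (q - p) * x) (trans (ℚₚ.*-comm s p) ps≡1) ⟩
    p + (q - p) * 1ℚ             ≡⟨ cong (λ x → p + x) (ℚₚ.*-identityʳ (q - p)) ⟩
    p + (q - p)                  ≡⟨ p+[q-p]≡q p q ⟩
    q                            ∎
    where open ≡-Reasoning

  ^-dominates : ∀ {p q} → 0ℚ < p → p < q → ∀ c →
    ∃ λ n → c * p ^ℚ suc n ≤ q ^ℚ suc n
  ^-dominates {p} {q} 0<p p<q c =
    let s , 0<s , ps≡1 = 1/pos 0<p
        0<t            = *-pos (p<q⇒0<q-p p<q) 0<s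
        n , c≤nt       = archimedean 0<t c
        n≤1+n          = subst (ι n ≤_) (sym (ι-suc n)) (q≤p+q (ℚₚ.<⇒≤ 0<1))
    in n , subst (λ x → c * p ^ℚ suc n ≤ x ^ℚ suc n) ([1+t]p≡q {p} {q} {s} ps≡1)
      (^-dominates′ (ℚₚ.<⇒≤ 0<t) (ℚₚ.<⇒≤ 0<p) c (suc n)
        (ℚₚ.≤-trans c≤nt (*-monoʳ-≤ (ℚₚ.<⇒≤ 0<t) n≤1+n)))

  module _ (b : ℚ) .{{_ : NonZero b}} where

    private
      bb⁻¹x≡x : ∀ x → b * (1/ b * x) ≡ x
      bb⁻¹x≡x x = trans (sym (ℚₚ.*-assoc b (1/ b) x))
        (trans (cong (_* x) (ℚₚ.*-inverseʳ b)) (ℚₚ.*-identityˡ x))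

    ^ℤ-suc : ∀ z → b ^ℤ ℤ.suc z ≡ b * b ^ℤ z
    ^ℤ-suc (+ n)          = refl
    ^ℤ-suc -[1+ zero ]    = sym (bb⁻¹x≡x 1ℚ)
    ^ℤ-suc -[1+ suc n ]   = sym (bb⁻¹x≡x ((1/ b) ^ℚ suc n))

    ^ℤ-+ℕ : ∀ z n → b ^ℤ (+ n ℤ.+ z) ≡ b ^ℚ n * b ^ℤ z
    ^ℤ-+ℕ z zero    = trans (cong (b ^ℤ_) (ℤₚ.+-identityˡ z)) (sym (ℚₚ.*-identityˡ _))
    ^ℤ-+ℕ z (suc n) = begin
      b ^ℤ (+ suc n ℤ.+ z)         ≡⟨ cong (b ^ℤ_) (ℤₚ.+-assoc (+ 1) (+ n) z) ⟩
      b ^ℤ ℤ.suc (+ n ℤ.+ z)       ≡⟨ ^ℤ-suc (+ n ℤ.+ z) ⟩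
      b * b ^ℤ (+ n ℤ.+ z)         ≡⟨ cong (b *_) (^ℤ-+ℕ z n) ⟩
      b * (b ^ℚ n * b ^ℤ z)        ≡⟨ sym (ℚₚ.*-assoc b (b ^ℚ n) (b ^ℤ z)) ⟩
      b ^ℚ suc n * b ^ℤ z          ∎
      where open ≡-Reasoning

    ^ℤ-pos : 0ℚ < b → ∀ z → 0ℚ < b ^ℤ z
    ^ℤ-pos 0<b (+ n)    = ^-pos n 0<b
    ^ℤ-pos 0<b -[1+ n ] = ^-pos {1/ b} (suc n)
      (ℚₚ.positive⁻¹ _ {{ℚₚ.1/pos⇒pos b {{positive 0<b}}}})

    ^ℤ-homo-+ : ∀ y z → b ^ℤ (y ℤ.+ z) ≡ b ^ℤ y * b ^ℤ z
    ^ℤ-homo-+ (+ n)    z = ^ℤ-+ℕ z n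
    ^ℤ-homo-+ -[1+ n ] z = begin
      b ^ℤ w                                 ≡⟨ sym (ℚₚ.*-identityˡ _) ⟩
      1ℚ * b ^ℤ w                            ≡⟨ cong (_* b ^ℤ w) (sym inv) ⟩
      b ^ℚ suc n * b ^ℤ -[1+ n ] * b ^ℤ w    ≡⟨ solve 3 (λ x y w → x :* y :* w := y :* (x :* w)) refl
                                                  (b ^ℚ suc n) (b ^ℤ -[1+ n ]) (b ^ℤ w) ⟩
      b ^ℤ -[1+ n ] * (b ^ℚ suc n * b ^ℤ w)  ≡⟨ cong (b ^ℤ -[1+ n ] *_) (sym (^ℤ-+ℕ w (suc n))) ⟩
      b ^ℤ -[1+ n ] * b ^ℤ (+ suc n ℤ.+ w)   ≡⟨ cong (λ x → b ^ℤ -[1+ n ] * b ^ℤ x) back ⟩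
      b ^ℤ -[1+ n ] * b ^ℤ z                 ∎
      where
      open ≡-Reasoning
      w = -[1+ n ] ℤ.+ z
      inv : b ^ℚ suc n * b ^ℤ -[1+ n ] ≡ 1ℚ
      inv = trans (sym (^ℤ-+ℕ -[1+ n ] (suc n))) (cong (b ^ℤ_) (ℤₚ.+-inverseʳ (+ suc n)))
      back : + suc n ℤ.+ w ≡ z
      back = trans (sym (ℤₚ.+-assoc (+ suc n) -[1+ n ] z))
        (trans (cong (ℤ._+ z) (ℤₚ.+-inverseʳ (+ suc n))) (ℤₚ.+-identityˡ z))

    ^ℤ-assocʳ : ∀ z n → (b ^ℤ z) ^ℚ n ≡ b ^ℤ (z ℤ.* + n)
    ^ℤ-assocʳ z zero    = cong (b ^ℤ_) (sym (ℤₚ.*-zeroʳ z))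
    ^ℤ-assocʳ z (suc n) = begin
      b ^ℤ z * (b ^ℤ z) ^ℚ n       ≡⟨ cong (b ^ℤ z *_) (^ℤ-assocʳ z n) ⟩
      b ^ℤ z * b ^ℤ (z ℤ.* + n)    ≡⟨ sym (^ℤ-homo-+ z (z ℤ.* + n)) ⟩
      b ^ℤ (z ℤ.+ z ℤ.* + n)       ≡⟨ cong (b ^ℤ_) (sym (ℤₚ.*-suc z (+ n))) ⟩
      b ^ℤ (z ℤ.* + suc n)         ∎
      where open ≡-Reasoning

    ^ℤ-mono-≤ : 1ℚ ≤ b → ∀ {y z} → y ℤ.≤ z → b ^ℤ y ≤ b ^ℤ z
    ^ℤ-mono-≤ 1≤b {y} {z} y≤z with z ℤ.- y | ℤₚ.i≤j⇒0≤j-i y≤z | [z-y]+y≡z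
      where
      [z-y]+y≡z : (z ℤ.- y) ℤ.+ y ≡ z
      [z-y]+y≡z = trans (ℤₚ.+-assoc z (ℤ.- y) y)
        (trans (cong (λ x → z ℤ.+ x) (ℤₚ.+-inverseˡ y)) (ℤₚ.+-identityʳ z))
    ... | + n | _ | n+y≡z = subst (b ^ℤ y ≤_) (trans (sym (^ℤ-+ℕ y n)) (cong (b ^ℤ_) n+y≡z))
        (subst (_≤ b ^ℚ n * b ^ℤ y) (ℚₚ.*-identityˡ _)
          (*-monoʳ-≤ (ℚₚ.<⇒≤ (^ℤ-pos 0<b y)) (1≤^ n)))
      where
      0<b = ℚₚ.<-≤-trans 0<1 1≤b
      1≤^ : ∀ n → 1ℚ ≤ b ^ℚ n
      1≤^ zero    = ℚₚ.≤-refl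
      1≤^ (suc n) = *-mono-≤ (ℚₚ.<⇒≤ 0<1) (^-nonNeg n (ℚₚ.<⇒≤ 0<b)) 1≤b (1≤^ n)

    ^ℤ-mono-< : 1ℚ < b → ∀ {y z} → y ℤ.< z → b ^ℤ y < b ^ℤ z
    ^ℤ-mono-< 1<b {y} {z} y<z = ℚₚ.<-≤-trans lem
        (^ℤ-mono-≤ (ℚₚ.<⇒≤ 1<b) (ℤₚ.i<j⇒suc[i]≤j y<z))
      where
      lem : b ^ℤ y < b ^ℤ ℤ.suc y
      lem = subst₂ _<_ (ℚₚ.*-identityˡ _) (sym (^ℤ-suc y))
        (*-monoʳ-< (^ℤ-pos (ℚₚ.<-trans 0<1 1<b) y) 1<b)

    ^ℤ-cross-≤ : 1ℚ ≤ b → ∀ {r s} → r ≤ s →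
      (b ^ℤ ↥ r) ^ℚ ↧ₙ s ≤ (b ^ℤ ↥ s) ^ℚ ↧ₙ r
    ^ℤ-cross-≤ 1≤b {r} {s} r≤s = subst₂ _≤_
      (sym (^ℤ-assocʳ (↥ r) (↧ₙ s))) (sym (^ℤ-assocʳ (↥ s) (↧ₙ r)))
      (^ℤ-mono-≤ 1≤b (ℚₚ.drop-*≤* r≤s))

    ^ℤ-cross-< : 1ℚ < b → ∀ {r s} → r < s →
      (b ^ℤ ↥ r) ^ℚ ↧ₙ s < (b ^ℤ ↥ s) ^ℚ ↧ₙ r
    ^ℤ-cross-< 1<b {r} {s} r<s = subst₂ _<_
      (sym (^ℤ-assocʳ (↥ r) (↧ₙ s))) (sym (^ℤ-assocʳ (↥ s) (↧ₙ r)))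
      (^ℤ-mono-< 1<b (ℚₚ.drop-*<* r<s))

  ^-exchange : ∀ x c d → (x ^ℚ c) ^ℚ d ≡ (x ^ℚ d) ^ℚ c
  ^-exchange x c d = trans (^-assocʳ x c d)
    (trans (cong (x ^ℚ_) (ℕₚ.*-comm c d)) (sym (^-assocʳ x d c)))

open Powers

-- Real numbers, as two-sided located Dedekind cuts of ℚ.
-- L q says q < x and U q says x < q.

record ℝ : Set₁ where
  field
    L U         : Pred ℚ 0ℓ
    L-inhabited : ∃ L
    U-inhabited : ∃ U
    L-down      : ∀ {p q} → p < q → L q → L p
    U-up        : ∀ {p q} → p < q → U p → U q
    L-open      : ∀ {q} → L q → ∃ λ r → q < r × L r
    U-open      : ∀ {q} → U q → ∃ λ r → r < q × U r
    disjoint    : ∀ {q} → L q → U q → ⊥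
    located     : ∀ {p q} → p < q → L p ⊎ U q

open ℝ

infix 4 _≤ᴿ_ _<ᴿ_

_≤ᴿ_ : ℝ → ℝ → Set
x ≤ᴿ y = ∀ {q} → L x q → L y q

_<ᴿ_ : ℝ → ℝ → Set
x <ᴿ y = ∃ λ q → U x q × L y q

L<U : ∀ (x : ℝ) {p q} → L x p → U x q → p < q
L<U x {p} {q} lp uq with q ≤? p
... | no q≰p = ℚₚ.≰⇒> q≰p
... | yes q≤p with ℚₚ.<-cmp q p
...   | tri< q<p _ _ = contradiction uq (disjoint x (L-down x q<p lp))
...   | tri≈ _ refl _ = contradiction uq (disjoint x lp)
...   | tri> _ _ p<q = p<q

module Cuts where

  L-down-≤ : ∀ (x : ℝ) {p q} → p ≤ q → L x q → L x p
  L-down-≤ x {p} {q} p≤q lq with ℚₚ.<-cmp p q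
  ... | tri< p<q _ _  = L-down x p<q lq
  ... | tri≈ _ refl _ = lq
  ... | tri> _ _ q<p  = contradiction (ℚₚ.<-≤-trans q<p p≤q) (ℚₚ.<-irrefl refl)

  U-up-≤ : ∀ (x : ℝ) {p q} → p ≤ q → U x p → U x q
  U-up-≤ x {p} {q} p≤q up with ℚₚ.<-cmp p q
  ... | tri< p<q _ _  = U-up x p<q up
  ... | tri≈ _ refl _ = up
  ... | tri> _ _ q<p  = contradiction (ℚₚ.<-≤-trans q<p p≤q) (ℚₚ.<-irrefl refl)

  L-⊔ : ∀ (x : ℝ) {p q} → L x p → L x q → L x (p ⊔ q)
  L-⊔ x {p} {q} lp lq = [ (λ eq → subst (L x) (sym eq) lp) , (λ eq → subst (L x) (sym eq) lq) ]′
    (ℚₚ.⊔-sel p q)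

  ⊓-glb-< : ∀ {p q r} → r < p → r < q → r < p ⊓ q
  ⊓-glb-< {p} {q} {r} r<p r<q = [ (λ eq → subst (r <_) (sym eq) r<p) , (λ eq → subst (r <_) (sym eq) r<q) ]′
    (ℚₚ.⊓-sel p q)

  ⊔-lub-< : ∀ {p q r} → p < r → q < r → p ⊔ q < r
  ⊔-lub-< {p} {q} {r} p<r q<r = [ (λ eq → subst (_< r) (sym eq) p<r) , (λ eq → subst (_< r) (sym eq) q<r) ]′
    (ℚₚ.⊔-sel p q)

  p-1<p : ∀ p → p - 1ℚ < p
  p-1<p p = subst (p - 1ℚ <_) (ℚₚ.+-identityʳ p)
    (ℚₚ.+-monoʳ-< p (ℚₚ.neg-antimono-< 0<1))

  p<p+1 : ∀ p → p < p + 1ℚ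
  p<p+1 p = p<p+q 0<1

  <-or-≥ : ∀ p q → p < q ⊎ q ≤ p
  <-or-≥ p q with p <? q
  ... | yes p<q = inj₁ p<q
  ... | no  p≮q = inj₂ (ℚₚ.≮⇒≥ p≮q)

  abstract
    walk : ∀ (x : ℝ) {h} → 0ℚ < h → ∀ n {a} → L x a → U x (a + ι n * h) →
      ∃ λ a′ → a ≤ a′ × L x a′ × U x (a′ + (h + h))
    walk x {h} 0<h zero {a} la ua = contradiction
      (subst (U x) (trans (cong (λ z → a + z * h) ι-zero)
        (trans (cong (λ z → a + z) (ℚₚ.*-zeroˡ h)) (ℚₚ.+-identityʳ a))) ua)
      (disjoint x la)
    walk x {h} 0<h (suc n) {a} la ua =
      [ (λ la+h → let a′ , a+h≤a′ , rest = walk x 0<h n la+h (subst (U x) eq ua)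
                  in a′ , ℚₚ.≤-trans (p≤p+q (ℚₚ.<⇒≤ 0<h)) a+h≤a′ , rest)
      , (λ ua+2h → a , ℚₚ.≤-refl , la , ua+2h)
      ]′ (located x (ℚₚ.+-monoʳ-< a (p<p+q 0<h)))
      where
      eq : a + ι (suc n) * h ≡ (a + h) + ι n * h
      eq = begin
        a + ι (suc n) * h       ≡⟨ cong (λ z → a + z * h) (ι-suc n) ⟩
        a + (1ℚ + ι n) * h      ≡⟨ cong (λ z → a + z) (ℚₚ.*-distribʳ-+ h 1ℚ (ι n)) ⟩
        a + (1ℚ * h + ι n * h)  ≡⟨ cong (λ z → a + (z + ι n * h)) (ℚₚ.*-identityˡ h) ⟩
        a + (h + ι n * h)       ≡⟨ sym (ℚₚ.+-assoc a h (ι n * h)) ⟩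
        (a + h) + ι n * h       ∎
        where open ≡-Reasoning

  abstract
    dense : ∀ {p q} → p < q → ∃ λ r → p < r × r < q
    dense = ℚₚ.<-dense

  p½+p½≡p : ∀ p → p * ½ + p * ½ ≡ p
  p½+p½≡p p = trans (sym (ℚₚ.*-distribˡ-+ p ½ ½)) (ℚₚ.*-identityʳ p)

  0<p½ : ∀ {p} → 0ℚ < p → 0ℚ < p * ½
  0<p½ 0<p = *-pos 0<p (ℚₚ.positive⁻¹ ½)

  -- Rational approximation to within δ, refining a given lower bound.
  abstract
    approx : ∀ (x : ℝ) {a δ} → 0ℚ < δ → L x a →
      ∃ λ a′ → a ≤ a′ × L x a′ × U x (a′ + δ)
    approx x {a} {δ} 0<δ la =
      let b , ub           = U-inhabited x
          n , b-a≤nh       = archimedean (0<p½ 0<δ) (b - a)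
          b≤a+nh           = subst (_≤ a + ι n * (δ * ½)) (p+[q-p]≡q a b) (ℚₚ.+-monoʳ-≤ a b-a≤nh)
          a′ , a≤ , la′ , ua′ = walk x (0<p½ 0<δ) n la (U-up-≤ x b≤a+nh ub)
      in a′ , a≤ , la′ , subst (λ z → U x (a′ + z)) (p½+p½≡p δ) ua′

open Cuts

fromℚ : ℚ → ℝ
fromℚ p .L q = q < p
fromℚ p .U q = p < q
fromℚ p .L-inhabited = p - 1ℚ , p-1<p p
fromℚ p .U-inhabited = p + 1ℚ , p<p+1 p
fromℚ p .L-down = ℚₚ.<-trans
fromℚ p .U-up q<r p<q = ℚₚ.<-trans p<q q<r
fromℚ p .L-open = dense
fromℚ p .U-open p<q = let r , p<r , r<q = dense p<q in r , r<q , p<r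
fromℚ p .disjoint q<p p<q = ℚₚ.<-asym q<p p<q
fromℚ p .located {q} {r} q<r = [ inj₁ , (λ p≤q → inj₂ (ℚₚ.≤-<-trans p≤q q<r)) ]′ (<-or-≥ q p)

infix  8 -ᴿ_
infixl 6 _+ᴿ_

-ᴿ_ : ℝ → ℝ
(-ᴿ x) .L q = U x (- q)
(-ᴿ x) .U q = L x (- q)
(-ᴿ x) .L-inhabited = let u , uu = U-inhabited x in - u , subst (U x) (sym (neg-neg u)) uu
(-ᴿ x) .U-inhabited = let l , ll = L-inhabited x in - l , subst (L x) (sym (neg-neg l)) ll
(-ᴿ x) .L-down p<q = U-up x (ℚₚ.neg-antimono-< p<q)
(-ᴿ x) .U-up p<q = L-down x (ℚₚ.neg-antimono-< p<q)
(-ᴿ x) .L-open {q} u = let r , r<-q , ur = U-open x u in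
  - r , subst (_< - r) (neg-neg q) (ℚₚ.neg-antimono-< r<-q) , subst (U x) (sym (neg-neg r)) ur
(-ᴿ x) .U-open {q} l = let r , -q<r , lr = L-open x l in
  - r , subst (- r <_) (neg-neg q) (ℚₚ.neg-antimono-< -q<r) , subst (L x) (sym (neg-neg r)) lr
(-ᴿ x) .disjoint u l = disjoint x l u
(-ᴿ x) .located p<q = [ inj₂ , inj₁ ]′ (located x (ℚₚ.neg-antimono-< p<q))

_+ᴿ_ : ℝ → ℝ → ℝ
(x +ᴿ y) .L q = ∃₂ λ a b → L x a × L y b × q < a + b
(x +ᴿ y) .U q = ∃₂ λ a b → U x a × U y b × a + b < q
(x +ᴿ y) .L-inhabited =
  let a , la = L-inhabited x ; b , lb = L-inhabited y in
  a + b - 1ℚ , a , b , la , lb , p-1<p (a + b)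
(x +ᴿ y) .U-inhabited =
  let a , ua = U-inhabited x ; b , ub = U-inhabited y in
  a + b + 1ℚ , a , b , ua , ub , p<p+1 (a + b)
(x +ᴿ y) .L-down p<q (a , b , la , lb , q<) = a , b , la , lb , ℚₚ.<-trans p<q q<
(x +ᴿ y) .U-up p<q (a , b , ua , ub , <p) = a , b , ua , ub , ℚₚ.<-trans <p p<q
(x +ᴿ y) .L-open (a , b , la , lb , q<) =
  let r , q<r , r< = dense q< in r , q<r , a , b , la , lb , r<
(x +ᴿ y) .U-open (a , b , ua , ub , <q) =
  let r , <r , r<q = dense <q in r , r<q , a , b , ua , ub , <r
(x +ᴿ y) .disjoint (a , b , la , lb , q<) (a′ , b′ , ua , ub , <q) =
  ℚₚ.<-asym (ℚₚ.+-mono-< (L<U x la ua) (L<U y lb ub)) (ℚₚ.<-trans <q q<)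
(x +ᴿ y) .located {p} {q} p<q =
  let m , p<m , m<q    = dense p<q
      0<δ              = 0<p½ (p<q⇒0<q-p p<m)
      a , _ , la , ua  = approx x 0<δ (proj₂ (L-inhabited x))
      b , _ , lb , ub  = approx y 0<δ (proj₂ (L-inhabited y))
  in [ (λ p<a+b → inj₁ (a , b , la , lb , p<a+b))
     , (λ a+b≤p → inj₂ (_ , _ , ua , ub , ℚₚ.≤-<-trans (bound a b a+b≤p) m<q))
     ]′ (<-or-≥ p (a + b))
  where
  bound : ∀ a b {p m} → a + b ≤ p → (a + (m - p) * ½) + (b + (m - p) * ½) ≤ m
  bound a b {p} {m} a+b≤p = begin
    (a + δ) + (b + δ)   ≡⟨ solve 3 (λ a b d → (a :+ d) :+ (b :+ d) := (a :+ b) :+ (d :+ d)) refl a b δ ⟩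
    (a + b) + (δ + δ)   ≡⟨ cong (λ z → (a + b) + z) (p½+p½≡p (m - p)) ⟩
    (a + b) + (m - p)   ≤⟨ ℚₚ.+-monoˡ-≤ (m - p) a+b≤p ⟩
    p + (m - p)         ≡⟨ p+[q-p]≡q p m ⟩
    m                   ∎
    where
    open ≤R
    δ = (m - p) * ½

module Products where

  -- A product is bounded by its values at the corners of a rectangle.
  segment-< : ∀ {a p b q c} → a ≤ p → p ≤ b → q < a * c → q < b * c → q < p * c
  segment-< {a} {p} {b} {q} {c} a≤p p≤b q<ac q<bc with ℚₚ.≤-total 0ℚ c
  ... | inj₁ 0≤c = ℚₚ.<-≤-trans q<ac (*-monoʳ-≤ 0≤c a≤p)
  ... | inj₂ c≤0 = ℚₚ.<-≤-trans q<bc (ℚₚ.*-monoʳ-≤-nonPos c {{nonPositive c≤0}} p≤b)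

  segment-> : ∀ {a p b q c} → a ≤ p → p ≤ b → a * c < q → b * c < q → p * c < q
  segment-> {a} {p} {b} {q} {c} a≤p p≤b ac<q bc<q with ℚₚ.≤-total 0ℚ c
  ... | inj₁ 0≤c = ℚₚ.≤-<-trans (*-monoʳ-≤ 0≤c p≤b) bc<q
  ... | inj₂ c≤0 = ℚₚ.≤-<-trans (ℚₚ.*-monoʳ-≤-nonPos c {{nonPositive c≤0}} a≤p) ac<q

open Products

minProduct maxProduct : (a b c d : ℚ) → ℚ
minProduct a b c d = ((a * c) ⊓ (a * d)) ⊓ ((b * c) ⊓ (b * d))
maxProduct a b c d = ((a * c) ⊔ (a * d)) ⊔ ((b * c) ⊔ (b * d))

module ProductCuts where

  minProduct-≤ : ∀ {a b c d p r q} → a ≤ p → p ≤ b → c ≤ r → r ≤ d →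
    q < minProduct a b c d → q < p * r
  minProduct-≤ {a} {b} {c} {d} {p} {r} {q} a≤p p≤b c≤r r≤d q< =
    segment-< a≤p p≤b (edge a (ℚₚ.<-≤-trans q< (ℚₚ.p⊓q≤p _ _)))
                      (edge b (ℚₚ.<-≤-trans q< (ℚₚ.p⊓q≤q ((a * c) ⊓ (a * d)) _)))
    where
    edge : ∀ e → q < (e * c) ⊓ (e * d) → q < e * r
    edge e q< = subst (q <_) (ℚₚ.*-comm r e) (segment-< c≤r r≤d
      (subst (q <_) (ℚₚ.*-comm e c) (ℚₚ.<-≤-trans q< (ℚₚ.p⊓q≤p _ _)))
      (subst (q <_) (ℚₚ.*-comm e d) (ℚₚ.<-≤-trans q< (ℚₚ.p⊓q≤q (e * c) _))))

  ≤-maxProduct : ∀ {a b c d p r q} → a ≤ p → p ≤ b → c ≤ r → r ≤ d →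
    maxProduct a b c d < q → p * r < q
  ≤-maxProduct {a} {b} {c} {d} {p} {r} {q} a≤p p≤b c≤r r≤d <q =
    segment-> a≤p p≤b (edge a (ℚₚ.≤-<-trans (ℚₚ.p≤p⊔q _ _) <q))
                      (edge b (ℚₚ.≤-<-trans (ℚₚ.p≤q⊔p ((a * c) ⊔ (a * d)) _) <q))
    where
    edge : ∀ e → (e * c) ⊔ (e * d) < q → e * r < q
    edge e <q = subst (_< q) (ℚₚ.*-comm r e) (segment-> c≤r r≤d
      (subst (_< q) (ℚₚ.*-comm e c) (ℚₚ.≤-<-trans (ℚₚ.p≤p⊔q _ _) <q))
      (subst (_< q) (ℚₚ.*-comm e d) (ℚₚ.≤-<-trans (ℚₚ.p≤q⊔p (e * c) _) <q)))

  minProduct<maxProduct : ∀ (x y : ℝ) {a b c d a′ b′ c′ d′ q} →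
    L x a → U x b → L y c → U y d → q < minProduct a b c d →
    L x a′ → U x b′ → L y c′ → U y d′ → maxProduct a′ b′ c′ d′ < q → ⊥
  minProduct<maxProduct x y {a} {b} {c} {d} {a′} {b′} {c′} {d′} la ub lc ud q< la′ ub′ lc′ ud′ <q =
    ℚₚ.<-asym
      (minProduct-≤ (ℚₚ.p≤p⊔q a a′) (ℚₚ.<⇒≤ (L<U x l ub)) (ℚₚ.p≤p⊔q c c′) (ℚₚ.<⇒≤ (L<U y m ud)) q<)
      (≤-maxProduct (ℚₚ.p≤q⊔p a a′) (ℚₚ.<⇒≤ (L<U x l ub′)) (ℚₚ.p≤q⊔p c c′) (ℚₚ.<⇒≤ (L<U y m ud′)) <q)
    where
    l : L x (a ⊔ a′)
    l = L-⊔ x la la′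
    m : L y (c ⊔ c′)
    m = L-⊔ y lc lc′

  -- A mesh δ ≤ 1 such that δM < e.
  abstract
    mesh : ∀ {M e} → 0ℚ ≤ M → 0ℚ < e → ∃ λ δ → 0ℚ < δ × δ ≤ 1ℚ × δ * M < e
    mesh {M} {e} 0≤M 0<e =
      let 0<M+e : 0ℚ < M + e
          0<M+e = ℚₚ.+-mono-≤-< 0≤M 0<e
          s , 0<s , [M+e]s≡1 = 1/pos 0<M+e
          0<δ = *-pos 0<e 0<s
      in e * s , 0<δ
       , subst (e * s ≤_) [M+e]s≡1 (*-monoʳ-≤ (ℚₚ.<⇒≤ 0<s) (q≤p+q 0≤M))
       , subst (e * s * M <_) (eq s [M+e]s≡1) (p<p+q (*-pos 0<δ 0<e))
      where
      eq : ∀ s → (M + e) * s ≡ 1ℚ → e * s * M + e * s * e ≡ e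
      eq s [M+e]s≡1 = trans
        (solve 3 (λ M e s → e :* s :* M :+ e :* s :* e := e :* ((M :+ e) :* s)) refl M e s)
        (trans (cong (e *_) [M+e]s≡1) (ℚₚ.*-identityʳ e))

  small : ∀ {δ M e w} → 0ℚ ≤ δ → ∣ w ∣ ≤ M → δ * M < e → ∣ δ * w ∣ < e
  small {δ} {M} {e} {w} 0≤δ w≤M δM<e = ℚₚ.≤-<-trans
    (subst (_≤ δ * M) (sym (trans (ℚₚ.∣p*q∣≡∣p∣*∣q∣ δ w) (cong (_* ∣ w ∣) (ℚₚ.0≤p⇒∣p∣≡p 0≤δ))))
      (*-monoˡ-≤ 0≤δ w≤M)) δM<e

  near-> : ∀ {m q P z} → m ≤ P → ∣ z ∣ < m - q → q < P + z
  near-> {m} {q} {P} {z} m≤P ∣z∣< = subst (_< P + z) (lem m q) (ℚₚ.+-mono-≤-< m≤P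
    (ℚₚ.<-≤-trans (ℚₚ.neg-antimono-< ∣z∣<) (-∣p∣≤p z)))
    where
    lem : ∀ m q → m + - (m - q) ≡ q
    lem = solve 2 (λ m q → m :+ :- (m :- q) := q) refl

  near-< : ∀ {m e r P z} → P ≤ m → ∣ z ∣ < e → m + e ≤ r → P + z < r
  near-< {z = z} P≤m ∣z∣< m+e≤r =
    ℚₚ.<-≤-trans (ℚₚ.+-mono-≤-< P≤m (ℚₚ.≤-<-trans (p≤∣p∣ z) ∣z∣<)) m+e≤r

  corner : ∀ {δ M a c} → 0ℚ ≤ δ → δ ≤ 1ℚ → ∣ a ∣ + ∣ c ∣ + 1ℚ ≤ M →
    ∀ {e} → δ * M < e → (P : ℚ → Set) → (∀ {z} → ∣ z ∣ < e → P (a * c + z)) →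
    P (a * c) × P (a * (c + δ)) × P ((a + δ) * c) × P ((a + δ) * (c + δ))
  corner {δ} {M} {a} {c} 0≤δ δ≤1 ≤M δM<e P near =
      subst P (eq₀ a c) (near (small 0≤δ (ℚₚ.≤-trans (+-nonNeg (+-nonNeg 0≤a 0≤c) 0≤1) ≤M) δM<e))
    , subst P (eq₁ a c δ) (near (small 0≤δ (ℚₚ.≤-trans (ℚₚ.≤-trans (p≤p+q 0≤c) (p≤p+q 0≤1)) ≤M) δM<e))
    , subst P (eq₂ a c δ) (near (small 0≤δ (ℚₚ.≤-trans (ℚₚ.≤-trans (q≤p+q 0≤a) (p≤p+q 0≤1)) ≤M) δM<e))
    , subst P (eq₃ a c δ) (near (small 0≤δ (ℚₚ.≤-trans bound ≤M) δM<e))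
    where
    0≤1 = ℚₚ.<⇒≤ 0<1
    0≤a = ℚₚ.0≤∣p∣ a
    0≤c = ℚₚ.0≤∣p∣ c
    bound : ∣ a + c + δ ∣ ≤ ∣ a ∣ + ∣ c ∣ + 1ℚ
    bound = ℚₚ.≤-trans (ℚₚ.∣p+q∣≤∣p∣+∣q∣ (a + c) δ)
      (ℚₚ.+-mono-≤ (ℚₚ.∣p+q∣≤∣p∣+∣q∣ a c) (subst (_≤ 1ℚ) (sym (ℚₚ.0≤p⇒∣p∣≡p 0≤δ)) δ≤1))
    eq₀ : ∀ a c → a * c + δ * 0ℚ ≡ a * c
    eq₀ a c = trans (cong (λ z → a * c + z) (ℚₚ.*-zeroʳ δ)) (ℚₚ.+-identityʳ (a * c))
    eq₁ : ∀ a c δ → a * c + δ * a ≡ a * (c + δ)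
    eq₁ = solve 3 (λ a c δ → a :* c :+ δ :* a := a :* (c :+ δ)) refl
    eq₂ : ∀ a c δ → a * c + δ * c ≡ (a + δ) * c
    eq₂ = solve 3 (λ a c δ → a :* c :+ δ :* c := (a :+ δ) :* c) refl
    eq₃ : ∀ a c δ → a * c + δ * (a + c + δ) ≡ (a + δ) * (c + δ)
    eq₃ = solve 3 (λ a c δ → a :* c :+ δ :* (a :+ c :+ δ) := (a :+ δ) :* (c :+ δ)) refl

  Box : (x y : ℝ) → Rel ℚ 0ℓ → (ℚ → ℚ → ℚ → ℚ → ℚ) → Pred ℚ 0ℓ
  Box x y R f q = ∃₂ λ a b → ∃₂ λ c d → L x a × U x b × L y c × U y d × R q (f a b c d)

  abstract
    *-located : ∀ (x y : ℝ) {q r} → q < r →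
      Box x y _<_ minProduct q ⊎ Box x y _>_ maxProduct r
    *-located x y {q} {r} q<r =
      let a₀ , la₀ = L-inhabited x ; b₀ , ub₀ = U-inhabited x
          c₀ , lc₀ = L-inhabited y ; d₀ , ud₀ = U-inhabited y
          m , q<m , m<r = dense q<r
      in go a₀ b₀ c₀ d₀ la₀ ub₀ lc₀ ud₀ m q<m m<r
      where
      go : ∀ a₀ b₀ c₀ d₀ → L x a₀ → U x b₀ → L y c₀ → U y d₀ → ∀ m → q < m → m < r →
        Box x y _<_ minProduct q ⊎ Box x y _>_ maxProduct r
      go a₀ b₀ c₀ d₀ la₀ ub₀ lc₀ ud₀ m q<m m<r =
        let δ , 0<δ , δ≤1 , δM<e  = mesh 0≤M 0<e
            a , a₀≤a , la , ua    = approx x 0<δ la₀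
            c , c₀≤c , lc , uc    = approx y 0<δ lc₀
        in finish δ 0<δ δ≤1 δM<e a a₀≤a la ua c c₀≤c lc uc
        where
        M e : ℚ
        M = (∣ a₀ ∣ + ∣ b₀ ∣) + (∣ c₀ ∣ + ∣ d₀ ∣) + 1ℚ
        e = (m - q) ⊓ (r - m)
        0<e : 0ℚ < e
        0<e = ⊓-glb-< (p<q⇒0<q-p q<m) (p<q⇒0<q-p m<r)
        0≤M : 0ℚ ≤ M
        0≤M = +-nonNeg (+-nonNeg (+-nonNeg (ℚₚ.0≤∣p∣ a₀) (ℚₚ.0≤∣p∣ b₀))
          (+-nonNeg (ℚₚ.0≤∣p∣ c₀) (ℚₚ.0≤∣p∣ d₀))) (ℚₚ.<⇒≤ 0<1)
        finish : ∀ δ → 0ℚ < δ → δ ≤ 1ℚ → δ * M < e →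
          ∀ a → a₀ ≤ a → L x a → U x (a + δ) → ∀ c → c₀ ≤ c → L y c → U y (c + δ) →
          Box x y _<_ minProduct q ⊎ Box x y _>_ maxProduct r
        finish δ 0<δ δ≤1 δM<e a a₀≤a la ua c c₀≤c lc uc =
          [ (λ P<m → inj₂ (a , a + δ , c , c + δ , la , ua , lc , uc , below (corner {a = a} {c} (ℚₚ.<⇒≤ 0<δ) δ≤1 ≤M δM<e (_< r)
              (λ {z} ∣z∣<e → near-< (ℚₚ.<⇒≤ P<m) (ℚₚ.<-≤-trans ∣z∣<e (ℚₚ.p⊓q≤q (m - q) (r - m)))
                (ℚₚ.≤-reflexive (p+[q-p]≡q m r))))))
          , (λ m≤P → inj₁ (a , a + δ , c , c + δ , la , ua , lc , uc , above (corner {a = a} {c} (ℚₚ.<⇒≤ 0<δ) δ≤1 ≤M δM<e (q <_)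
              (λ {z} ∣z∣<e → near-> m≤P (ℚₚ.<-≤-trans ∣z∣<e (ℚₚ.p⊓q≤p (m - q) (r - m)))))))
          ]′ (<-or-≥ (a * c) m)
          where
          ≤M : ∣ a ∣ + ∣ c ∣ + 1ℚ ≤ M
          ≤M = ℚₚ.+-monoˡ-≤ 1ℚ (ℚₚ.+-mono-≤
            (between⇒∣∣≤ a₀≤a (ℚₚ.<⇒≤ (L<U x la ub₀)))
            (between⇒∣∣≤ c₀≤c (ℚₚ.<⇒≤ (L<U y lc ud₀))))
          below : a * c < r × a * (c + δ) < r × (a + δ) * c < r × (a + δ) * (c + δ) < r →
            maxProduct a (a + δ) c (c + δ) < r
          below (p₁ , p₂ , p₃ , p₄) = ⊔-lub-< (⊔-lub-< p₁ p₂) (⊔-lub-< p₃ p₄)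
          above : q < a * c × q < a * (c + δ) × q < (a + δ) * c × q < (a + δ) * (c + δ) →
            q < minProduct a (a + δ) c (c + δ)
          above (p₁ , p₂ , p₃ , p₄) = ⊓-glb-< (⊓-glb-< p₁ p₂) (⊓-glb-< p₃ p₄)

open ProductCuts

infixl 7 _*ᴿ_

-- The product of two bounded intervals is the interval between the least
-- and the greatest product of endpoints.
_*ᴿ_ : ℝ → ℝ → ℝ
(x *ᴿ y) .L q = ∃₂ λ a b → ∃₂ λ c d →
  L x a × U x b × L y c × U y d × q < minProduct a b c d
(x *ᴿ y) .U q = ∃₂ λ a b → ∃₂ λ c d →
  L x a × U x b × L y c × U y d × maxProduct a b c d < q
(x *ᴿ y) .L-inhabited =
  let a , la = L-inhabited x ; b , ub = U-inhabited x
      c , lc = L-inhabited y ; d , ud = U-inhabited y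
  in _ , a , b , c , d , la , ub , lc , ud , p-1<p (minProduct a b c d)
(x *ᴿ y) .U-inhabited =
  let a , la = L-inhabited x ; b , ub = U-inhabited x
      c , lc = L-inhabited y ; d , ud = U-inhabited y
  in _ , a , b , c , d , la , ub , lc , ud , p<p+1 (maxProduct a b c d)
(x *ᴿ y) .L-down p<q (a , b , c , d , la , ub , lc , ud , q<) =
  a , b , c , d , la , ub , lc , ud , ℚₚ.<-trans p<q q<
(x *ᴿ y) .U-up p<q (a , b , c , d , la , ub , lc , ud , <p) =
  a , b , c , d , la , ub , lc , ud , ℚₚ.<-trans <p p<q
(x *ᴿ y) .L-open (a , b , c , d , la , ub , lc , ud , q<) =
  let r , q<r , r< = dense q< in r , q<r , a , b , c , d , la , ub , lc , ud , r<
(x *ᴿ y) .U-open (a , b , c , d , la , ub , lc , ud , <q) =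
  let r , <r , r<q = dense <q in r , r<q , a , b , c , d , la , ub , lc , ud , <r
(x *ᴿ y) .disjoint (a , b , c , d , la , ub , lc , ud , q<) (a′ , b′ , c′ , d′ , la′ , ub′ , lc′ , ud′ , <q) =
  minProduct<maxProduct x y la ub lc ud q< la′ ub′ lc′ ud′ <q
(x *ᴿ y) .located = *-located x y

module Logarithms where

  1<fromℕ2 : 1ℚ < fromℕ 2
  1<fromℕ2 = *<* (ℤ.+<+ (ℕ.s≤s (ℕ.s≤s ℕ.z≤n)))

  p≤p^n : ∀ {p} n .{{_ : ℕ.NonZero n}} → 1ℚ ≤ p → p ≤ p ^ℚ n
  p≤p^n {p} (suc n) 1≤p = subst (_≤ p ^ℚ suc n) (ℚₚ.*-identityʳ p)
    (*-monoˡ-≤ (ℚₚ.≤-trans (ℚₚ.<⇒≤ 0<1) 1≤p) (1≤p^n n))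
    where
    1≤p^n : ∀ n → 1ℚ ≤ p ^ℚ n
    1≤p^n zero    = ℚₚ.≤-refl
    1≤p^n (suc n) = *-mono-≤ (ℚₚ.<⇒≤ 0<1) (ℚₚ.≤-trans (ℚₚ.<⇒≤ 0<1) (1≤p^n n)) 1≤p (1≤p^n n)

  0^n≡0 : ∀ n .{{_ : ℕ.NonZero n}} → 0ℚ ^ℚ n ≡ 0ℚ
  0^n≡0 (suc n) = ℚₚ.*-zeroˡ (0ℚ ^ℚ n)

  integral : ℤ → ℚ
  integral z = mkℚ z 0 (Coprimality.sym (Coprimality.1-coprimeTo ℤ.∣ z ∣))

  unitFraction : ℕ → ℚ
  unitFraction m = mkℚ (+ 1) m (Coprimality.1-coprimeTo (suc m))

  module _ (N : ℚ) (0<N : 0ℚ < N) where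

    log₂-disjoint : ∀ {q s t} → q < s → 2 ^ᶻ ↥ s ≤ N ^ℚ ↧ₙ s →
      t < q → N ^ℚ ↧ₙ t ≤ 2 ^ᶻ ↥ t → ⊥
    log₂-disjoint {q} {s} {t} q<s 2ˢ≤N t<q N≤2ᵗ = ℚₚ.<-irrefl refl (begin-strict
      (2 ^ᶻ ↥ t) ^ℚ ↧ₙ s    <⟨ ^ℤ-cross-< (fromℕ 2) 1<fromℕ2 (ℚₚ.<-trans t<q q<s) ⟩
      (2 ^ᶻ ↥ s) ^ℚ ↧ₙ t    ≤⟨ ^-mono-≤ (↧ₙ t) (ℚₚ.<⇒≤ (^ℤ-pos (fromℕ 2) (0<fromℕ 2) (↥ s))) 2ˢ≤N ⟩
      (N ^ℚ ↧ₙ s) ^ℚ ↧ₙ t    ≡⟨ ^-exchange N (↧ₙ s) (↧ₙ t) ⟩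
      (N ^ℚ ↧ₙ t) ^ℚ ↧ₙ s    ≤⟨ ^-mono-≤ (↧ₙ s) (^-nonNeg (↧ₙ t) (ℚₚ.<⇒≤ 0<N)) N≤2ᵗ ⟩
      (2 ^ᶻ ↥ t) ^ℚ ↧ₙ s    ∎)
      where open ≤R

    log₂-bounded : ∃ λ s → N ^ℚ ↧ₙ s ≤ 2 ^ᶻ ↥ s
    log₂-bounded =
      let m , N1≤2ᵐ = ^-dominates 0<1 1<fromℕ2 N
      in integral (+ suc m) , subst (_≤ fromℕ 2 ^ℚ suc m)
        (cong (N *_) (1^n≡1 (suc m))) N1≤2ᵐ
      where
      1^n≡1 : ∀ n → 1ℚ ^ℚ n ≡ 1ℚ
      1^n≡1 zero    = refl
      1^n≡1 (suc n) = trans (ℚₚ.*-identityˡ (1ℚ ^ℚ n)) (1^n≡1 n)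

open Logarithms

-- log₂ n = sup { s ∈ ℚ : 2ˢ ≤ n }, where for s = a / d the inequality
-- 2ˢ ≤ n reads 2ᵃ ≤ nᵈ.
log₂ : (n : ℕ) → .{{ℕ.NonZero n}} → ℝ
log₂ n .L q = ∃ λ s → q < s × 2 ^ᶻ ↥ s ≤ fromℕ n ^ℚ ↧ₙ s
log₂ n .U q = ∃ λ s → s < q × fromℕ n ^ℚ ↧ₙ s ≤ 2 ^ᶻ ↥ s
log₂ n .L-inhabited = integral -[1+ 0 ] , integral (+ 0) , *<* ℤ.-<+ ,
  subst (1ℚ ≤_) (sym (ℚₚ.*-identityʳ (fromℕ n))) (1≤fromℕ n)
log₂ n .U-inhabited =
  let s , n≤2ˢ = log₂-bounded (fromℕ n) (0<fromℕ n) in s + 1ℚ , s , p<p+1 s , n≤2ˢ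
log₂ n .L-down p<q (s , q<s , h) = s , ℚₚ.<-trans p<q q<s , h
log₂ n .U-up p<q (s , s<p , h) = s , ℚₚ.<-trans s<p p<q , h
log₂ n .L-open (s , q<s , h) = let r , q<r , r<s = dense q<s in r , q<r , s , r<s , h
log₂ n .U-open (s , s<q , h) = let r , s<r , r<q = dense s<q in r , r<q , s , s<r , h
log₂ n .disjoint (s , q<s , 2ˢ≤n) (t , t<q , n≤2ᵗ) =
  log₂-disjoint (fromℕ n) (0<fromℕ n) q<s 2ˢ≤n t<q n≤2ᵗ
log₂ n .located p<q =
  let s , p<s , s<q = dense p<q in
  [ (λ h → inj₁ (s , p<s , h)) , (λ h → inj₂ (s , s<q , h)) ]′ (ℚₚ.≤-total _ _)

module RealPowers where

  module _ (N : ℚ) .{{_ : NonZero N}} (1≤N : 1ℚ ≤ N) where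

    private
      0<N : 0ℚ < N
      0<N = ℚₚ.<-≤-trans 0<1 1≤N

    ^-disjoint : ∀ {r s p p′} → r < s → 0ℚ ≤ p → p ^ℚ ↧ₙ r ≤ N ^ℤ ↥ r →
      0ℚ ≤ p′ → N ^ℤ ↥ s ≤ p′ ^ℚ ↧ₙ s → p ≤ p′
    ^-disjoint {r} {s} {p} {p′} r<s 0≤p p≤Nʳ 0≤p′ Nˢ≤p′ =
      ^-cancel-≤ (↧ₙ s) 0≤p′ (^-cancel-≤ (↧ₙ r) (^-nonNeg (↧ₙ s) 0≤p′) (begin
        (p ^ℚ ↧ₙ s) ^ℚ ↧ₙ r    ≡⟨ ^-exchange p (↧ₙ s) (↧ₙ r) ⟩
        (p ^ℚ ↧ₙ r) ^ℚ ↧ₙ s    ≤⟨ ^-mono-≤ (↧ₙ s) (^-nonNeg (↧ₙ r) 0≤p) p≤Nʳ ⟩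
        (N ^ℤ ↥ r) ^ℚ ↧ₙ s     ≤⟨ ^ℤ-cross-≤ N 1≤N (ℚₚ.<⇒≤ r<s) ⟩
        (N ^ℤ ↥ s) ^ℚ ↧ₙ r     ≤⟨ ^-mono-≤ (↧ₙ r) (ℚₚ.<⇒≤ (^ℤ-pos N 0<N (↥ s))) Nˢ≤p′ ⟩
        (p′ ^ℚ ↧ₙ s) ^ℚ ↧ₙ r   ∎))
      where open ≤R

    -- If N^r < p₁ and N p₁ᵐ ≤ p₂ᵐ, then N^(r + 1/m) ≤ p₂.
    ^-step : ∀ r k {p₁ p₂} → 0ℚ ≤ p₁ → 0ℚ ≤ p₂ → N ^ℤ ↥ r ≤ p₁ ^ℚ ↧ₙ r →
      N * p₁ ^ℚ suc k ≤ p₂ ^ℚ suc k →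
      ∀ s → s ≡ r + unitFraction k → N ^ℤ ↥ s ≤ p₂ ^ℚ ↧ₙ s
    ^-step r k {p₁} {p₂} 0≤p₁ 0≤p₂ Nʳ≤p₁ Np₁≤p₂ s s≡ =
      ^-cancel-≤ (d ℕ.* m) (^-nonNeg d′ 0≤p₂) (begin
        (N ^ℤ a′) ^ℚ (d ℕ.* m)                  ≡⟨ ^ℤ-assocʳ N a′ (d ℕ.* m) ⟩
        N ^ℤ (a′ ℤ.* + (d ℕ.* m))               ≡⟨ cong (N ^ℤ_) cross ⟩
        N ^ℤ ((a ℤ.* + m ℤ.+ + 1 ℤ.* + d) ℤ.* + d′) ≡⟨ sym (^ℤ-assocʳ N (a ℤ.* + m ℤ.+ + 1 ℤ.* + d) d′) ⟩
        (N ^ℤ (a ℤ.* + m ℤ.+ + 1 ℤ.* + d)) ^ℚ d′ ≡⟨ cong (_^ℚ d′) (^ℤ-homo-+ N (a ℤ.* + m) (+ 1 ℤ.* + d)) ⟩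
        (N ^ℤ (a ℤ.* + m) * N ^ℤ (+ 1 ℤ.* + d)) ^ℚ d′
          ≡⟨ cong₂ (λ x y → (x * N ^ℤ y) ^ℚ d′) (sym (^ℤ-assocʳ N a m)) (ℤₚ.*-identityˡ (+ d)) ⟩
        ((N ^ℤ a) ^ℚ m * N ^ℚ d) ^ℚ d′          ≤⟨ ^-mono-≤ d′ (*-nonNeg (^-nonNeg m 0≤Na) (^-nonNeg d 0≤N))
                                                     (*-monoʳ-≤ (^-nonNeg d 0≤N) (^-mono-≤ m 0≤Na Nʳ≤p₁)) ⟩
        ((p₁ ^ℚ d) ^ℚ m * N ^ℚ d) ^ℚ d′         ≡⟨ cong (_^ℚ d′) (trans (ℚₚ.*-comm ((p₁ ^ℚ d) ^ℚ m) (N ^ℚ d))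
                                                     (cong (N ^ℚ d *_) (^-exchange p₁ d m))) ⟩
        (N ^ℚ d * (p₁ ^ℚ m) ^ℚ d) ^ℚ d′         ≡⟨ cong (_^ℚ d′) (sym (^-distrib N (p₁ ^ℚ m) d)) ⟩
        ((N * p₁ ^ℚ m) ^ℚ d) ^ℚ d′              ≤⟨ ^-mono-≤ d′ (^-nonNeg d 0≤Np₁) (^-mono-≤ d 0≤Np₁ Np₁≤p₂) ⟩
        ((p₂ ^ℚ m) ^ℚ d) ^ℚ d′                  ≡⟨ ^-exchange (p₂ ^ℚ m) d d′ ⟩
        ((p₂ ^ℚ m) ^ℚ d′) ^ℚ d                  ≡⟨ cong (_^ℚ d) (^-exchange p₂ m d′) ⟩
        ((p₂ ^ℚ d′) ^ℚ m) ^ℚ d                  ≡⟨ ^-exchange (p₂ ^ℚ d′) m d ⟩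
        ((p₂ ^ℚ d′) ^ℚ d) ^ℚ m                  ≡⟨ ^-assoc (p₂ ^ℚ d′) d m ⟩
        (p₂ ^ℚ d′) ^ℚ (d ℕ.* m)                 ∎)
      where
      open ≤R
      m d d′ : ℕ
      m  = suc k
      d  = ↧ₙ r
      d′ = ↧ₙ s
      a a′ : ℤ
      a  = ↥ r
      a′ = ↥ s
      0≤N : 0ℚ ≤ N
      0≤N = ℚₚ.<⇒≤ 0<N
      0≤Na : 0ℚ ≤ N ^ℤ a
      0≤Na = ℚₚ.<⇒≤ (^ℤ-pos N 0<N a)
      0≤Np₁ : 0ℚ ≤ N * p₁ ^ℚ m
      0≤Np₁ = *-nonNeg 0≤N (^-nonNeg m 0≤p₁)
      cross : a′ ℤ.* + (d ℕ.* m) ≡ (a ℤ.* + m ℤ.+ + 1 ℤ.* + d) ℤ.* + d′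
      cross = numerators r s (ℚᵘₚ.≃-trans (ℚᵘₚ.≃-reflexive (cong toℚᵘ s≡))
        (ℚₚ.toℚᵘ-homo-+ r (unitFraction k)))
        where
        numerators : ∀ r s → toℚᵘ s ℚᵘ.≃ toℚᵘ r ℚᵘ.+ toℚᵘ (unitFraction k) →
          ↥ s ℤ.* + (↧ₙ r ℕ.* m) ≡ (↥ r ℤ.* + m ℤ.+ + 1 ℤ.* + ↧ₙ r) ℤ.* + ↧ₙ s
        numerators (mkℚ _ _ _) (mkℚ _ _ _) (ℚᵘ.*≡* eq) = eq

    abstract
      ^-located : ∀ (y : ℝ) {q q′} → q < q′ →
        (∃₂ λ r p → L y r × q < p × 0ℚ ≤ p × p ^ℚ ↧ₙ r ≤ N ^ℤ ↥ r) ⊎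
        (∃₂ λ r p → U y r × p < q′ × 0ℚ ≤ p × N ^ℤ ↥ r ≤ p ^ℚ ↧ₙ r)
      ^-located y {q} {q′} q<q′ = [ negative-q , nonNegative-q ]′ (<-or-≥ q 0ℚ)
        where
        Below Above : Set
        Below = ∃₂ λ r p → L y r × q < p × 0ℚ ≤ p × p ^ℚ ↧ₙ r ≤ N ^ℤ ↥ r
        Above = ∃₂ λ r p → U y r × p < q′ × 0ℚ ≤ p × N ^ℤ ↥ r ≤ p ^ℚ ↧ₙ r

        negative-q : q < 0ℚ → Below ⊎ Above
        negative-q q<0 =
          let r , lr = L-inhabited y
          in inj₁ (r , 0ℚ , lr , q<0 , ℚₚ.≤-refl , 0^≤ r)
          where
          0^≤ : ∀ r → 0ℚ ^ℚ ↧ₙ r ≤ N ^ℤ ↥ r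
          0^≤ r = subst (_≤ N ^ℤ ↥ r) (sym (0^n≡0 (↧ₙ r))) (ℚₚ.<⇒≤ (^ℤ-pos N 0<N (↥ r)))

        decide : ∀ p₁ p₂ → q < p₁ → 0ℚ ≤ p₁ → p₂ < q′ → 0ℚ ≤ p₂ →
          ∀ k → N * p₁ ^ℚ suc k ≤ p₂ ^ℚ suc k →
          ∀ r → L y r → U y (r + unitFraction k) → Below ⊎ Above
        decide p₁ p₂ q<p₁ 0≤p₁ p₂<q′ 0≤p₂ k Np₁≤p₂ r lr ur =
          [ (λ h → inj₁ (r , p₁ , lr , q<p₁ , 0≤p₁ , h))
          , (λ h → inj₂ (r + unitFraction k , p₂ , ur , p₂<q′ , 0≤p₂
                        , ^-step r k 0≤p₁ 0≤p₂ h Np₁≤p₂ (r + unitFraction k) refl))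
          ]′ (ℚₚ.≤-total (p₁ ^ℚ ↧ₙ r) (N ^ℤ ↥ r))

        nonNegative-q : 0ℚ ≤ q → Below ⊎ Above
        nonNegative-q 0≤q =
          let p₁ , q<p₁ , p₁<q′ = dense q<q′
              p₂ , p₁<p₂ , p₂<q′ = dense p₁<q′
              0<p₁ = ℚₚ.≤-<-trans 0≤q q<p₁
              k , Np₁≤p₂ = ^-dominates 0<p₁ p₁<p₂ N
              r , _ , lr , ur = approx y (ℚₚ.positive⁻¹ (unitFraction k)) (proj₂ (L-inhabited y))
          in decide p₁ p₂ q<p₁ (ℚₚ.<⇒≤ 0<p₁) p₂<q′ (ℚₚ.<⇒≤ (ℚₚ.<-trans 0<p₁ p₁<p₂))
               k Np₁≤p₂ r lr ur

open RealPowers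

infixr 8 _^ᴿ_

-- n ^ y = sup { p ∈ ℚ : 0 ≤ p and p ≤ nʳ for some rational r < y }, where for
-- r = a / d the inequality p ≤ nʳ reads pᵈ ≤ nᵃ.
_^ᴿ_ : (n : ℕ) → .{{ℕ.NonZero n}} → ℝ → ℝ
(n ^ᴿ y) .L q = ∃₂ λ r p → L y r × q < p × 0ℚ ≤ p × p ^ℚ ↧ₙ r ≤ n ^ᶻ ↥ r
(n ^ᴿ y) .U q = ∃₂ λ r p → U y r × p < q × 0ℚ ≤ p × n ^ᶻ ↥ r ≤ p ^ℚ ↧ₙ r
(n ^ᴿ y) .L-inhabited =
  let r , lr = L-inhabited y in
  0ℚ - 1ℚ , r , 0ℚ , lr , p-1<p 0ℚ , ℚₚ.≤-refl ,
  subst (_≤ n ^ᶻ ↥ r) (sym (0^n≡0 (↧ₙ r))) (ℚₚ.<⇒≤ (^ℤ-pos (fromℕ n) {{fromℕ-nonZero n}} (0<fromℕ n) (↥ r)))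
(n ^ᴿ y) .U-inhabited =
  let r , ur = U-inhabited y
      c      = n ^ᶻ ↥ r
      0≤c    = ℚₚ.<⇒≤ (^ℤ-pos (fromℕ n) {{fromℕ-nonZero n}} (0<fromℕ n) (↥ r))
      1≤1+c  = p≤p+q {1ℚ} 0≤c
  in (1ℚ + c) + 1ℚ , r , 1ℚ + c , ur , p<p+1 (1ℚ + c) ,
     ℚₚ.≤-trans (ℚₚ.<⇒≤ 0<1) 1≤1+c ,
     ℚₚ.≤-trans (q≤p+q (ℚₚ.<⇒≤ 0<1)) (p≤p^n (↧ₙ r) 1≤1+c)
(n ^ᴿ y) .L-down q<q′ (r , p , lr , q′<p , h) = r , p , lr , ℚₚ.<-trans q<q′ q′<p , h
(n ^ᴿ y) .U-up q<q′ (r , p , ur , p<q , h) = r , p , ur , ℚₚ.<-trans p<q q<q′ , h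
(n ^ᴿ y) .L-open (r , p , lr , q<p , h) =
  let q′ , q<q′ , q′<p = dense q<p in q′ , q<q′ , r , p , lr , q′<p , h
(n ^ᴿ y) .U-open (r , p , ur , p<q , h) =
  let q′ , p<q′ , q′<q = dense p<q in q′ , q′<q , r , p , ur , p<q′ , h
(n ^ᴿ y) .disjoint (r , p , lr , q<p , 0≤p , p≤nʳ) (s , p′ , us , p′<q , 0≤p′ , nˢ≤p′) =
  ℚₚ.<-irrefl refl (ℚₚ.<-≤-trans (ℚₚ.<-trans p′<q q<p)
    (^-disjoint (fromℕ n) {{fromℕ-nonZero n}} (1≤fromℕ n) (L<U y lr us) 0≤p p≤nʳ 0≤p′ nˢ≤p′))
(n ^ᴿ y) .located q<q′ = ^-located (fromℕ n) {{fromℕ-nonZero n}} (1≤fromℕ n) y q<q′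

TendsToZero : (∀ n → .{{ℕ.NonZero n}} → ℝ) → Set₁
TendsToZero ε = ∀ δ → fromℚ 0ℚ <ᴿ δ →
  ∃ λ N → ∀ n .{{_ : ℕ.NonZero n}} → N ℕ.≤ n → -ᴿ δ <ᴿ ε n × ε n <ᴿ δ

record Graph (n : ℕ) : Set₁ where
  field
    _~_    : Rel (Fin n) 0ℓ
    _~?_   : Decidable _~_
    sym~   : Symmetric _~_
    irrefl : Irreflexive _≡_ _~_

IsClique : ∀ {n} → Graph n → Subset n → Set
IsClique G S = ∀ u v → u ∈ S → v ∈ S → u ≢ v → u ~ v
  where open Graph G

IsIndependent : ∀ {n} → Graph n → Subset n → Set
IsIndependent G S = ∀ u v → u ∈ S → v ∈ S → ¬ (u ~ v)
  where open Graph G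

isClique? : ∀ {n} (G : Graph n) (S : Subset n) → Dec (IsClique G S)
isClique? G S = Fin.all? λ u → Fin.all? λ v →
  (u ∈? S) →-dec ((v ∈? S) →-dec (¬? (u Fin.≟ v) →-dec (u ~? v)))
  where open Graph G

isIndependent? : ∀ {n} (G : Graph n) (S : Subset n) → Dec (IsIndependent G S)
isIndependent? G S = Fin.all? λ u → Fin.all? λ v →
  (u ∈? S) →-dec ((v ∈? S) →-dec ¬? (u ~? v))
  where open Graph G

-- Every subset of Fin n, listed exactly once.
subsets : ∀ n → List (Subset n)
subsets zero    = [] ∷ []
subsets (suc n) = map (outside ∷_) (subsets n) ++ map (inside ∷_) (subsets n)

k : ∀ {n} → Graph n → ℕ
k G = length (filter (isClique? G) (subsets _))

i : ∀ {n} → Graph n → ℕ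
i G = length (filter (isIndependent? G) (subsets _))

π : ∀ {n} → Graph n → ℕ
π G = i G ℕ.* k G

K : ∀ n → Graph n
K n = record
  { _~_    = _≢_
  ; _~?_   = λ u v → ¬? (u Fin.≟ v)
  ; sym~   = λ u≢v v≡u → u≢v (sym v≡u)
  ; irrefl = λ u≡v u≢v → u≢v u≡v
  }

E : ∀ n → Graph n
E n = record
  { _~_    = λ _ _ → ⊥
  ; _~?_   = λ _ _ → no λ ()
  ; sym~   = λ ()
  ; irrefl = λ _ ()
  }

{-# OPTIONS --safe #-}
-- Let v be the first vertex, N and M the sets of its neighbours and non-neighbours among
-- the others. Then i(G) = i(G - v) + i(M) and k(G) = k(G - v) + k(N), hence
-- π(G) ≥ π(G - v) + π(N) + π(M), and one of N, M contains half of the remaining vertices.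
-- So if A bounds π from below on graphs with at least x vertices, then sA does on graphs
-- with at least 2x + s vertices. Starting from 1 and taking x = t 2ᵗ, s = 2ᵗ⁺¹ gives
-- π(G) ≥ 2^(t(t+1)/2) as soon as n ≥ t 2ᵗ, and t may be chosen as log₂ n - O(log log n).
-- The upper bound is an induction on the vertices for the number of pairs of a clique in P
-- and an independent set in Q, which is at most (|P ∩ Q| + 1) 2ⁿ.
module Submission where

open import Defs
open Order hiding (*-mono-≤; *-monoʳ-≤; *-monoˡ-≤; *-monoʳ-<)
open Embedding
open Powers
open Cuts
open ProductCuts
open Logarithms
open ℝ
open import Data.Bool using (Bool; true; false; not; _∧_; T; if_then_else_)
open import Data.Bool.Properties using (T-∧)
open import Data.Empty using (⊥-elim)
open import Data.Fin using (Fin; zero; suc)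
import Data.Fin.Properties as Fin
open import Data.Fin.Subset using (Subset; inside; outside; _∈_)
open import Data.Integer as ℤ using (-[1+_])
import Data.Integer.Properties as ℤ
open import Data.List using ([]; _∷_; _++_; map; filter; length)
open import Data.List.Properties using (length-++; filter-++; filter-none)
open import Data.List.Relation.Unary.All using (universal)
open import Data.Nat using (ℕ; zero; suc; NonZero; _+_; _*_; _∸_; _^_; _≤_; _<_; _≤?_; z≤n; s≤s; ⌊_/2⌋; ⌈_/2⌉)
open import Data.Nat.Logarithm
open import Data.Nat.Properties
open import Data.Nat.Tactic.RingSolver using (solve-∀)
open import Data.Product using (∃; _×_; _,_; proj₁; proj₂)
open import Data.Rational as ℚ using (ℚ; mkℚ; 0ℚ; 1ℚ; ½; ↥_; ↧ₙ_; toℚᵘ)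
import Data.Rational.Properties as ℚ
import Data.Rational.Solver as ℚ-Solver
import Data.Rational.Unnormalised as ℚᵘ
import Data.Rational.Unnormalised.Properties as ℚᵘ
open import Data.Unit using (tt)
open import Data.Vec using (here; there; []; _∷_)
open import Function using (_∘_; const)
open import Function.Bundles using (Equivalence)
open import Relation.Binary.PropositionalEquality
  using (_≡_; _≢_; refl; sym; trans; cong; cong₂; subst; subst₂; module ≡-Reasoning)
open import Relation.Nullary using (¬_; Dec; yes; no; does; contradiction)

-- Counting cliques inside a vertex set

BoolRel : ℕ → Set
BoolRel n = Fin n → Fin n → Bool

shift : ∀ {n} → BoolRel (suc n) → BoolRel n
shift r u v = r (suc u) (suc v)

complement : ∀ {n} → BoolRel n → BoolRel n
complement r u v = not (r u v)

size : ∀ {n} → (Fin n → Bool) → ℕ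
size {zero}  P = 0
size {suc n} P = (if P zero then 1 else 0) + size (P ∘ suc)

-- The number of subsets of P whose distinct elements are pairwise related by r,
-- those containing the vertex 0 being counted inside its neighbourhood.
cliques : ∀ {n} → BoolRel n → (Fin n → Bool) → ℕ
cliques {zero}  r P = 1
cliques {suc n} r P = cliques (shift r) (P ∘ suc) +
  (if P zero then cliques (shift r) (λ v → P (suc v) ∧ r zero (suc v)) else 0)

cliques-mono : ∀ {n} (r : BoolRel n) P Q → (∀ v → T (P v) → T (Q v)) →
  cliques r P ≤ cliques r Q
cliques-mono {zero}  r P Q P⊆Q = ≤-refl
cliques-mono {suc n} r P Q P⊆Q with P zero | Q zero | P⊆Q zero
... | false | _     | _   = +-mono-≤ (cliques-mono (shift r) (P ∘ suc) (Q ∘ suc) (P⊆Q ∘ suc)) z≤n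
... | true  | false | imp = ⊥-elim (imp tt)
... | true  | true  | _   = +-mono-≤ (cliques-mono (shift r) (P ∘ suc) (Q ∘ suc) (P⊆Q ∘ suc))
  (cliques-mono (shift r) (λ v → P (suc v) ∧ r zero (suc v)) (λ v → Q (suc v) ∧ r zero (suc v))
    λ v t → let p , a = Equivalence.to T-∧ t in Equivalence.from T-∧ (P⊆Q (suc v) p , a))

cliques-∧ˡ : ∀ {n} (r : BoolRel n) P (Q : Fin n → Bool) → cliques r (λ v → P v ∧ Q v) ≤ cliques r P
cliques-∧ˡ r P Q = cliques-mono r (λ v → P v ∧ Q v) P λ v t → proj₁ (Equivalence.to T-∧ t)

1≤cliques : ∀ {n} (r : BoolRel n) P → 1 ≤ cliques r P
1≤cliques {zero}  r P = ≤-refl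
1≤cliques {suc n} r P = m≤n⇒m≤n+o _ (1≤cliques (shift r) (P ∘ suc))

size-cong : ∀ {n} {P Q : Fin n → Bool} → (∀ v → P v ≡ Q v) → size P ≡ size Q
size-cong {zero}  P≗Q = refl
size-cong {suc n} P≗Q =
  cong₂ (λ b s → (if b then 1 else 0) + s) (P≗Q zero) (size-cong (P≗Q ∘ suc))

size-split : ∀ {n} (P Q : Fin n → Bool) →
  size (λ v → P v ∧ Q v) + size (λ v → P v ∧ not (Q v)) ≡ size P
size-split {zero}  P Q = refl
size-split {suc n} P Q with P zero | Q zero
... | false | _     = size-split (P ∘ suc) (Q ∘ suc)
... | true  | true  = cong suc (size-split (P ∘ suc) (Q ∘ suc))
... | true  | false = trans (+-suc _ _) (cong suc (size-split (P ∘ suc) (Q ∘ suc)))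

size-true : ∀ n → size {n} (const true) ≡ n
size-true zero    = refl
size-true (suc n) = cong suc (size-true n)

-- Agreement of the recursive count with `k` and `i`

length-filter-map : ∀ {A B : Set} {D : B → Set} (D? : ∀ y → Dec (D y)) (f : A → B) xs →
  length (filter D? (map f xs)) ≡ length (filter (D? ∘ f) xs)
length-filter-map D? f []       = refl
length-filter-map D? f (x ∷ xs) with does (D? (f x))
... | true  = cong suc (length-filter-map D? f xs)
... | false = length-filter-map D? f xs

-- A common form for cliques and independent sets, relative to a ground set `P` because the
-- recursion of `cliques` shrinks it.
record Spans {n} (r : BoolRel n) (P : Fin n → Bool) (S : Subset n) : Set where
  constructor spans
  field
    within   : ∀ u → u ∈ S → T (P u)
    pairwise : ∀ u v → u ∈ S → v ∈ S → u ≢ v → T (r u v)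

open Spans

-- `D` is arbitrary up to equivalence with `Spans`, since fixing whether 0 belongs to the subset
-- turns it into `D ∘ (inside ∷_)` or `D ∘ (outside ∷_)`. Symmetry lets the neighbourhood of 0,
-- recorded from one side only, supply both orders of a pair.
filter-subsets : ∀ {n} (r : BoolRel n) P → (∀ u v → r u v ≡ r v u) →
  {D : Subset n → Set} (D? : ∀ S → Dec (D S)) →
  (∀ {S} → D S → Spans r P S) → (∀ {S} → Spans r P S → D S) →
  length (filter D? (subsets n)) ≡ cliques r P
filter-subsets {zero} r P r-sym D? to from with D? []
... | yes _  = refl
... | no  ¬d = contradiction (from (spans (λ u ()) λ u v ())) ¬d
filter-subsets {suc n} r P r-sym {D} D? to from = begin
  length (filter D? (map (outside ∷_) Ss ++ map (inside ∷_) Ss))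
    ≡⟨ cong length (filter-++ D? (map (outside ∷_) Ss) _) ⟩
  length (filter D? (map (outside ∷_) Ss) ++ filter D? (map (inside ∷_) Ss))
    ≡⟨ length-++ (filter D? (map (outside ∷_) Ss)) ⟩
  length (filter D? (map (outside ∷_) Ss)) + length (filter D? (map (inside ∷_) Ss))
    ≡⟨ cong₂ _+_ (trans (length-filter-map D? _ Ss) without)
                 (trans (length-filter-map D? _ Ss) (with-zero (P zero) refl)) ⟩
  cliques r P ∎
  where
  open ≡-Reasoning
  Ss = subsets n

  without : length (filter (D? ∘ (outside ∷_)) Ss) ≡ cliques (shift r) (P ∘ suc)
  without = filter-subsets (shift r) (P ∘ suc) (λ u v → r-sym (suc u) (suc v)) _
    (λ d → spans (λ u u∈ → within (to d) (suc u) (there u∈))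
                 (λ u v u∈ v∈ u≢v → pairwise (to d) (suc u) (suc v) (there u∈) (there v∈)
                   (u≢v ∘ Fin.suc-injective)))
    (λ s → from (spans (λ { (suc u) (there u∈) → within s u u∈ })
      λ { (suc u) (suc v) (there u∈) (there v∈) u≢v → pairwise s u v u∈ v∈ (u≢v ∘ cong suc) }))

  with-zero : ∀ b → P zero ≡ b → length (filter (D? ∘ (inside ∷_)) Ss) ≡
    (if b then cliques (shift r) (λ v → P (suc v) ∧ r zero (suc v)) else 0)
  with-zero false P0 = cong length (filter-none (D? ∘ (inside ∷_))
    (universal (λ S d → subst T P0 (within (to d) zero here)) Ss))
  with-zero true P0 =
    filter-subsets (shift r) (λ v → P (suc v) ∧ r zero (suc v)) (λ u v → r-sym (suc u) (suc v)) _
      (λ d → spans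
        (λ u u∈ → Equivalence.from T-∧
          (within (to d) (suc u) (there u∈) , pairwise (to d) zero (suc u) here (there u∈) λ ()))
        (λ u v u∈ v∈ u≢v → pairwise (to d) (suc u) (suc v) (there u∈) (there v∈)
          (u≢v ∘ Fin.suc-injective)))
      (λ s → from (spans
        (λ { zero _ → subst T (sym P0) tt
           ; (suc u) (there u∈) → proj₁ (Equivalence.to T-∧ (within s u u∈)) })
        (λ { zero zero _ _ 0≢0 → contradiction refl 0≢0
           ; zero (suc v) _ (there v∈) _ → proj₂ (Equivalence.to T-∧ (within s v v∈))
           ; (suc u) zero (there u∈) _ _ → subst T (r-sym zero (suc u))
               (proj₂ (Equivalence.to T-∧ (within s u u∈)))
           ; (suc u) (suc v) (there u∈) (there v∈) u≢v →
               pairwise s u v u∈ v∈ (u≢v ∘ cong suc) })))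

module _ {n} (G : Graph n) where
  open Graph G

  adjacent : BoolRel n
  adjacent u v = does (u ~? v)

  private
    adjacent-sym : ∀ u v → adjacent u v ≡ adjacent v u
    adjacent-sym u v with u ~? v | v ~? u
    ... | yes _   | yes _   = refl
    ... | no  _   | no  _   = refl
    ... | yes u~v | no  v≁u = contradiction (sym~ u~v) v≁u
    ... | no  u≁v | yes v~u = contradiction (sym~ v~u) u≁v

    ~⇒T : ∀ {u v} → u ~ v → T (adjacent u v)
    ~⇒T {u} {v} u~v with u ~? v
    ... | yes _   = tt
    ... | no  u≁v = u≁v u~v

    T⇒~ : ∀ {u v} → T (adjacent u v) → u ~ v
    T⇒~ {u} {v} t with u ~? v
    ... | yes u~v = u~v

    ≁⇒T : ∀ {u v} → ¬ (u ~ v) → T (complement adjacent u v)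
    ≁⇒T {u} {v} u≁v with u ~? v
    ... | yes u~v = u≁v u~v
    ... | no  _   = tt

    T⇒≁ : ∀ {u v} → T (complement adjacent u v) → ¬ (u ~ v)
    T⇒≁ {u} {v} t with u ~? v
    ... | no u≁v = u≁v

  k≡cliques : k G ≡ cliques adjacent (const true)
  k≡cliques = filter-subsets adjacent (const true) adjacent-sym (isClique? G)
    (λ c → spans (λ _ _ → tt) λ u v u∈ v∈ u≢v → ~⇒T (c u v u∈ v∈ u≢v))
    (λ s u v u∈ v∈ u≢v → T⇒~ (pairwise s u v u∈ v∈ u≢v))

  i≡cliques : i G ≡ cliques (complement adjacent) (const true)
  i≡cliques = filter-subsets (complement adjacent) (const true)
    (λ u v → cong not (adjacent-sym u v)) (isIndependent? G)
    (λ c → spans (λ _ _ → tt) λ u v u∈ v∈ _ → ≁⇒T (c u v u∈ v∈))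
    from
    where
    from : ∀ {S} → Spans (complement adjacent) (const true) S → IsIndependent G S
    -- `IsIndependent` also constrains u = v, which `Spans` leaves out; irreflexivity settles the
    -- diagonal.
    from s u v u∈ v∈ u~v = T⇒≁ (pairwise s u v u∈ v∈ (λ u≡v → irrefl u≡v u~v)) u~v

-- The lower bound

product : ∀ {n} → BoolRel n → (Fin n → Bool) → ℕ
product r P = cliques (complement r) P * cliques r P

π≡product : ∀ {n} (G : Graph n) → π G ≡ product (adjacent G) (const true)
π≡product G = cong₂ _*_ (i≡cliques G) (k≡cliques G)

expand : ∀ a b c d → (a + b) * (c + d) ≡ a * c + (a * d + b * c) + b * d
expand = solve-∀

-- A pair (A , B) that does not use the vertex 0 is counted by the first term;
-- otherwise restrict B to the neighbourhood of 0 if 0 ∈ A, and A to the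
-- non-neighbourhood if 0 ∈ B.
product-suc : ∀ {n} (r : BoolRel (suc n)) P → P zero ≡ true →
  product (shift r) (P ∘ suc)
  + (product (shift r) (λ v → P (suc v) ∧ r zero (suc v))
    + product (shift r) (λ v → P (suc v) ∧ not (r zero (suc v))))
  ≤ product r P
product-suc r P P0 rewrite P0 = begin
  I * C + (I₁ * C₁ + I₂ * C₂)  ≤⟨ +-monoʳ-≤ (I * C) (+-mono-≤
                                     (*-monoˡ-≤ C₁ (cliques-∧ˡ (complement r′) P′ (r zero ∘ suc)))
                                     (*-monoʳ-≤ I₂ (cliques-∧ˡ r′ P′ (not ∘ r zero ∘ suc)))) ⟩
  I * C + (I * C₁ + I₂ * C)    ≤⟨ m≤m+n _ (I₂ * C₁) ⟩
  I * C + (I * C₁ + I₂ * C) + I₂ * C₁ ≡⟨ expand I I₂ C C₁ ⟨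
  (I + I₂) * (C + C₁)          ∎
  where
  open ≤-Reasoning
  r′ = shift r
  P′ = P ∘ suc
  N = λ v → P (suc v) ∧ r zero (suc v)
  M = λ v → P (suc v) ∧ not (r zero (suc v))
  I = cliques (complement r′) P′
  C = cliques r′ P′
  I₁ = cliques (complement r′) N
  C₁ = cliques r′ N
  I₂ = cliques (complement r′) M
  C₂ = cliques r′ M

-- While P shrinks from 2x + s to 2x vertices, each removed vertex has at least x neighbours
-- or at least x non-neighbours among the remaining ones.
product-step : ∀ x A → (∀ {n} (r : BoolRel n) P → x ≤ size P → A ≤ product r P) →
  ∀ {n} s (r : BoolRel n) P → 2 * x + s ≤ size P → s * A ≤ product r P
product-step x A large {n} zero r P le = z≤n
-- No vertices are left, so `size P` is 0; rewriting the required size as a successor makes the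
-- hypothesis absurd.
product-step x A large {zero} (suc s) r P le with 2 * x + suc s | +-suc (2 * x) s
product-step x A large {zero} (suc s) r P () | _ | refl
product-step x A large {suc n} (suc s) r P le = by (P zero) refl
  where
  N = λ v → P (suc v) ∧ r zero (suc v)
  M = λ v → P (suc v) ∧ not (r zero (suc v))

  by : ∀ b → P zero ≡ b → suc s * A ≤ product r P
  -- Dropping a vertex outside `P` costs no size, so `s` stays and only `n` decreases.
  by false P0 = ≤-trans
    (product-step x A large (suc s) (shift r) (P ∘ suc)
      (subst (λ b → 2 * x + suc s ≤ (if b then 1 else 0) + size (P ∘ suc)) P0 le))
    (*-mono-≤ (m≤m+n (cliques (complement (shift r)) (P ∘ suc)) _)
              (m≤m+n (cliques (shift r) (P ∘ suc)) _))
  by true P0 = begin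
    A + s * A                ≡⟨ +-comm A (s * A) ⟩
    s * A + A                ≤⟨ +-mono-≤ (product-step x A large s (shift r) (P ∘ suc) le′) halves ⟩
    product (shift r) (P ∘ suc) + (product (shift r) N + product (shift r) M)
                             ≤⟨ product-suc r P P0 ⟩
    product r P              ∎
    where
    open ≤-Reasoning
    le′ : 2 * x + s ≤ size (P ∘ suc)
    le′ = ≤-pred (subst₂ (λ m b → m ≤ (if b then 1 else 0) + size (P ∘ suc)) (+-suc (2 * x) s) P0 le)
    halves : A ≤ product (shift r) N + product (shift r) M
    halves with x ≤? size N | x ≤? size M
    ... | yes x≤N | _       = m≤n⇒m≤n+o _ (large (shift r) N x≤N)
    ... | no _    | yes x≤M = m≤n⇒m≤o+n _ (large (shift r) M x≤M)
    ... | no x≰N  | no x≰M  = contradiction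
      (≤-trans (m≤m+n (2 * x) s) (≤-trans le′ (≤-reflexive (sym (size-split (P ∘ suc) _)))))
      (<⇒≱ (subst (size N + size M <_) (cong (x +_) (sym (+-identityʳ x)))
        (+-mono-< (≰⇒> x≰N) (≰⇒> x≰M))))

tri : ℕ → ℕ
tri zero    = 0
tri (suc t) = suc t + tri t

-- Since (t + 1) 2^(t + 1) = 2 (t 2^t) + 2^(t + 1), taking `s = 2 ^ suc t` in `product-step`
-- multiplies the bound by 2^(t + 1), which adds t + 1 to the exponent.
2^tri≤product : ∀ t {n} (r : BoolRel n) P → t * 2 ^ t ≤ size P → 2 ^ tri t ≤ product r P
2^tri≤product zero    r P _  = *-mono-≤ (1≤cliques (complement r) P) (1≤cliques r P)
2^tri≤product (suc t) r P le = begin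
  2 ^ (suc t + tri t)      ≡⟨ ^-distribˡ-+-* 2 (suc t) (tri t) ⟩
  2 ^ suc t * 2 ^ tri t    ≤⟨ product-step (t * 2 ^ t) (2 ^ tri t) (2^tri≤product t) (2 ^ suc t) r P
                                (≤-trans (≤-reflexive (eq t (2 ^ t))) le) ⟩
  product r P              ∎
  where
  open ≤-Reasoning
  eq : ∀ t z → 2 * (t * z) + 2 * z ≡ suc t * (2 * z)
  eq = solve-∀

2^tri≤π : ∀ t {n} (G : Graph n) → t * 2 ^ t ≤ n → 2 ^ tri t ≤ π G
2^tri≤π t {n} G le = subst (2 ^ tri t ≤_) (sym (π≡product G))
  (2^tri≤product t (adjacent G) (const true) (subst (t * 2 ^ t ≤_) (sym (size-true n)) le))

-- The upper bound

-- Two different ground sets P and Q keep the induction going: if 0 ∈ A, then B loses the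
-- neighbours of 0, and symmetrically.
cliques*cliques≤ : ∀ {n} (r : BoolRel n) P Q →
  cliques (complement r) Q * cliques r P ≤ (size (λ v → P v ∧ Q v) + 1) * 2 ^ n
cliques*cliques≤ {zero}  r P Q = ≤-refl
cliques*cliques≤ {suc n} r P Q = bound (P zero) (Q zero)
  where
  open ≤-Reasoning
  r′ = shift r
  P′ = P ∘ suc
  Q′ = Q ∘ suc
  N = λ v → P (suc v) ∧ r zero (suc v)
  M = λ v → Q (suc v) ∧ not (r zero (suc v))
  z = 2 ^ n
  c = size (λ v → P′ v ∧ Q′ v)
  cN = size (λ v → N v ∧ Q′ v)
  cM = size (λ v → P′ v ∧ M v)
  I = cliques (complement r′) Q′
  C = cliques r′ P′
  I₂ = cliques (complement r′) M
  C₁ = cliques r′ N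

  ∧-swap : ∀ p q b → (p ∧ b) ∧ q ≡ (p ∧ q) ∧ b
  ∧-swap true  true  true  = refl
  ∧-swap true  true  false = refl
  ∧-swap true  false true  = refl
  ∧-swap true  false false = refl
  ∧-swap false _     _     = refl

  ∧-assoc′ : ∀ p q b → p ∧ (q ∧ b) ≡ (p ∧ q) ∧ b
  ∧-assoc′ true  _ _ = refl
  ∧-assoc′ false _ _ = refl

  ∧-disjoint : ∀ p q b → (p ∧ b) ∧ (q ∧ not b) ≡ false
  ∧-disjoint false _     _     = refl
  ∧-disjoint true  _     false = refl
  ∧-disjoint true  true  true  = refl
  ∧-disjoint true  false true  = refl

  size-false : ∀ {n} {P : Fin n → Bool} → (∀ v → P v ≡ false) → size P ≡ 0
  size-false {zero}  eq = refl
  size-false {suc n} eq rewrite eq zero = size-false (eq ∘ suc)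

  cN+cM≡c : cN + cM ≡ c
  cN+cM≡c = trans
    (cong₂ _+_ (size-cong λ v → ∧-swap (P (suc v)) (Q (suc v)) (r zero (suc v)))
               (size-cong λ v → ∧-assoc′ (P (suc v)) (Q (suc v)) (not (r zero (suc v)))))
    (size-split (λ v → P′ v ∧ Q′ v) (r zero ∘ suc))

  IC   : I * C ≤ (c + 1) * z
  IC   = cliques*cliques≤ r′ P′ Q′
  IC₁  : I * C₁ ≤ (cN + 1) * z
  IC₁  = cliques*cliques≤ r′ N Q′
  I₂C  : I₂ * C ≤ (cM + 1) * z
  I₂C  = cliques*cliques≤ r′ P′ M
  -- `N` consists of neighbours of 0 and `M` of non-neighbours, so the induction hypothesis applies
  -- with an empty intersection.
  I₂C₁ : I₂ * C₁ ≤ 1 * z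
  I₂C₁ = subst (λ s → I₂ * C₁ ≤ (s + 1) * z)
    (size-false λ v → ∧-disjoint (P (suc v)) (Q (suc v)) (r zero (suc v)))
    (cliques*cliques≤ r′ N M)

  double : ∀ c z → (c + 1) * z + (c + 1) * z ≡ (c + 1) * (2 * z)
  double = solve-∀

  bound : ∀ p q →
    (I + (if q then I₂ else 0)) * (C + (if p then C₁ else 0)) ≤
    ((if p ∧ q then 1 else 0) + c + 1) * (2 * z)
  bound false false = begin
    (I + 0) * (C + 0)              ≡⟨ cong₂ _*_ (+-identityʳ I) (+-identityʳ C) ⟩
    I * C                          ≤⟨ IC ⟩
    (c + 1) * z                    ≤⟨ *-monoʳ-≤ (c + 1) (m≤m+n z _) ⟩
    (c + 1) * (2 * z)              ∎
  bound false true = begin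
    (I + I₂) * (C + 0)             ≡⟨ trans (cong ((I + I₂) *_) (+-identityʳ C)) (*-distribʳ-+ C I I₂) ⟩
    I * C + I₂ * C                 ≤⟨ +-mono-≤ IC I₂C ⟩
    (c + 1) * z + (cM + 1) * z     ≤⟨ +-monoʳ-≤ ((c + 1) * z) (*-monoˡ-≤ z (+-monoˡ-≤ 1
                                        (m+n≤o⇒n≤o cN (≤-reflexive cN+cM≡c)))) ⟩
    (c + 1) * z + (c + 1) * z      ≡⟨ double c z ⟩
    (c + 1) * (2 * z)              ∎
  bound true false = begin
    (I + 0) * (C + C₁)             ≡⟨ trans (cong (_* (C + C₁)) (+-identityʳ I)) (*-distribˡ-+ I C C₁) ⟩
    I * C + I * C₁                 ≤⟨ +-mono-≤ IC IC₁ ⟩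
    (c + 1) * z + (cN + 1) * z     ≤⟨ +-monoʳ-≤ ((c + 1) * z) (*-monoˡ-≤ z (+-monoˡ-≤ 1
                                        (m+n≤o⇒m≤o cN (≤-reflexive cN+cM≡c)))) ⟩
    (c + 1) * z + (c + 1) * z      ≡⟨ double c z ⟩
    (c + 1) * (2 * z)              ∎
  -- The sets counted by `cN` and `cM` partition the c common vertices other than 0, so the four
  -- bounds add up to (2c + 4) z, exactly the allowed (c + 2) 2z.
  bound true true = begin
    (I + I₂) * (C + C₁)                          ≡⟨ trans (expand I I₂ C C₁) (+-assoc (I * C) _ _) ⟩
    I * C + (I * C₁ + I₂ * C + I₂ * C₁)          ≤⟨ +-mono-≤ IC (+-mono-≤ (+-mono-≤ IC₁ I₂C) I₂C₁) ⟩
    (c + 1) * z + ((cN + 1) * z + (cM + 1) * z + 1 * z) ≡⟨ collect c cN cM z ⟩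
    ((c + (cN + cM)) + 4) * z                    ≡⟨ cong (λ s → ((c + s) + 4) * z) cN+cM≡c ⟩
    ((c + c) + 4) * z                            ≡⟨ double+2 c z ⟩
    (suc c + 1) * (2 * z)                        ∎
    where
    collect : ∀ c a b z →
      (c + 1) * z + ((a + 1) * z + (b + 1) * z + 1 * z) ≡ ((c + (a + b)) + 4) * z
    collect = solve-∀
    double+2 : ∀ c z → ((c + c) + 4) * z ≡ (suc c + 1) * (2 * z)
    double+2 = solve-∀

π≤ : ∀ {n} (G : Graph n) → π G ≤ (n + 1) * 2 ^ n
π≤ {n} G = subst₂ (λ p s → p ≤ (s + 1) * 2 ^ n) (sym (π≡product G)) (size-true n)
  (cliques*cliques≤ (adjacent G) (const true) (const true))

-- The extremal graphs

cliques-complete : ∀ {n} (r : BoolRel n) P → (∀ u v → u ≢ v → T (r u v)) → (∀ v → T (P v)) →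
  cliques r P ≡ 2 ^ n
cliques-complete {zero}  r P r-all P-all = refl
cliques-complete {suc n} r P r-all P-all with P zero | P-all zero
... | true | _ = trans
  (cong₂ _+_ (cliques-complete (shift r) (P ∘ suc) r-all′ (P-all ∘ suc))
    (cliques-complete (shift r) (λ v → P (suc v) ∧ r zero (suc v)) r-all′
      (λ v → Equivalence.from T-∧ (P-all (suc v) , r-all zero (suc v) λ ()))))
  (cong (2 ^ n +_) (sym (+-identityʳ (2 ^ n))))
  where
  r-all′ : ∀ u v → u ≢ v → T (r (suc u) (suc v))
  r-all′ u v u≢v = r-all (suc u) (suc v) (u≢v ∘ Fin.suc-injective)

cliques-of-empty : ∀ {n} (r : BoolRel n) P → (∀ v → ¬ T (P v)) → cliques r P ≡ 1
cliques-of-empty {zero}  r P P-none = refl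
cliques-of-empty {suc n} r P P-none with P zero | P-none zero
... | true  | ¬tt = contradiction tt ¬tt
... | false | _   = trans (+-identityʳ _) (cliques-of-empty (shift r) (P ∘ suc) (P-none ∘ suc))

-- The only clique through 0 is {0}, so each vertex adds one. Only distinct pairs are constrained
-- because complementing an irreflexive relation puts a loop at every vertex.
cliques-edgeless : ∀ {n} (r : BoolRel n) P → (∀ u v → u ≢ v → ¬ T (r u v)) → (∀ v → T (P v)) →
  cliques r P ≡ n + 1
cliques-edgeless {zero}  r P r-none P-all = refl
cliques-edgeless {suc n} r P r-none P-all with P zero | P-all zero
... | true | _ = trans
  (cong₂ _+_ (cliques-edgeless (shift r) (P ∘ suc)
      (λ u v u≢v → r-none (suc u) (suc v) (u≢v ∘ Fin.suc-injective)) (P-all ∘ suc))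
    (cliques-of-empty (shift r) (λ v → P (suc v) ∧ r zero (suc v))
      (λ v t → r-none zero (suc v) (λ ()) (proj₂ (Equivalence.to T-∧ t)))))
  (+-comm (n + 1) 1)

private
  adjacent-K : ∀ {n} (u v : Fin n) → u ≢ v → adjacent (K n) u v ≡ true
  adjacent-K u v u≢v with u Fin.≟ v
  ... | yes u≡v = contradiction u≡v u≢v
  ... | no  _   = refl

π-K : ∀ n → π (K n) ≡ (n + 1) * 2 ^ n
π-K n = trans (π≡product (K n)) (cong₂ _*_
  (cliques-edgeless (complement (adjacent (K n))) (const true)
    (λ u v u≢v → subst (T ∘ not) (adjacent-K u v u≢v)) (λ _ → tt))
  (cliques-complete (adjacent (K n)) (const true)
    (λ u v u≢v → subst T (sym (adjacent-K u v u≢v)) tt) (λ _ → tt)))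

π-E : ∀ n → π (E n) ≡ (n + 1) * 2 ^ n
π-E n = trans (π≡product (E n)) (trans (cong₂ _*_
  (cliques-complete (complement (adjacent (E n))) (const true) (λ _ _ _ → tt) (λ _ → tt))
  (cliques-edgeless (adjacent (E n)) (const true) (λ _ _ _ ()) (λ _ → tt)))
  (*-comm (2 ^ n) (n + 1)))

-- Arithmetic of the exponent

n<2^1+⌊log₂n⌋ : ∀ n → n < 2 ^ suc ⌊log₂ n ⌋
n<2^1+⌊log₂n⌋ n = ≰⇒> λ 2^1+l≤n → 1+n≰n
  (subst (_≤ ⌊log₂ n ⌋) (⌊log₂[2^n]⌋≡n (suc ⌊log₂ n ⌋)) (⌊log₂⌋-mono-≤ 2^1+l≤n))

2^⌊log₂n⌋≤n : ∀ n .{{_ : NonZero n}} → 2 ^ ⌊log₂ n ⌋ ≤ n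
2^⌊log₂n⌋≤n n = go ⌊log₂ n ⌋ n refl
  where
  -- Induction on the value l of the logarithm, which halving n lowers by one.
  go : ∀ l n .{{_ : NonZero n}} → ⌊log₂ n ⌋ ≡ l → 2 ^ l ≤ n
  go zero    (suc n)         _  = s≤s z≤n
  go (suc l) n@(suc (suc m)) eq = begin
    2 * 2 ^ l                 ≤⟨ *-monoʳ-≤ 2 (go l ⌊ n /2⌋ (trans (⌊log₂⌊n/2⌋⌋≡⌊log₂n⌋∸1 n) (cong (_∸ 1) eq))) ⟩
    2 * ⌊ n /2⌋               ≡⟨ cong (⌊ n /2⌋ +_) (+-identityʳ ⌊ n /2⌋) ⟩
    ⌊ n /2⌋ + ⌊ n /2⌋         ≤⟨ +-monoʳ-≤ ⌊ n /2⌋ (⌊n/2⌋≤⌈n/2⌉ n) ⟩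
    ⌊ n /2⌋ + ⌈ n /2⌉         ≡⟨ ⌊n/2⌋+⌈n/2⌉≡n n ⟩
    n                         ∎
    where open ≤-Reasoning

-- The shape `2 + f` is that of `loss ℓ` with f = ⌊log₂ ℓ⌋. Past `f₀`, raising f by one adds D on
-- the left and doubles the right.
2^-dominates-linear : ∀ D → ∃ λ f₀ → ∀ f → f₀ ≤ f → D * (2 + f) < 2 ^ f
2^-dominates-linear D = f₀ , λ f f₀≤f → subst (λ f → D * (2 + f) < 2 ^ f) (m∸n+n≡m f₀≤f) (from-f₀ (f ∸ f₀))
  where
  open ≤-Reasoning
  z = 2 ^ D
  -- As D ≤ z = 2^D, the product D (6 + 2D) is at most 8 z², below 16 z² = 2^(4 + 2D).
  f₀ = 4 + (D + D)

  D<z : ∀ D → D < 2 ^ D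
  D<z zero    = s≤s z≤n
  D<z (suc D) = begin-strict
    suc D            <⟨ +-mono-≤-< (m^n>0 2 D) (D<z D) ⟩
    2 ^ D + 2 ^ D    ≡⟨ cong (2 ^ D +_) (sym (+-identityʳ (2 ^ D))) ⟩
    2 ^ suc D        ∎

  D≤2^ : ∀ x → D ≤ 2 ^ (x + f₀)
  D≤2^ x = ≤-trans (<⇒≤ (D<z D)) (^-monoʳ-≤ 2 (≤-trans (m≤m+n D D) (≤-trans (m≤n+m (D + D) 4) (m≤n+m f₀ x))))

  from-f₀ : ∀ x → D * (2 + (x + f₀)) < 2 ^ (x + f₀)
  from-f₀ zero = begin-strict
    D * (6 + (D + D))         ≤⟨ *-mono-≤ (<⇒≤ (D<z D)) (+-mono-≤ (*-monoʳ-≤ 6 (m^n>0 2 D)) (+-mono-≤ (<⇒≤ (D<z D)) (<⇒≤ (D<z D)))) ⟩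
    z * (6 * z + (z + z))     ≡⟨ eq z ⟩
    8 * (z * z)               <⟨ *-monoˡ-< (z * z) {{m*n≢0 z z {{m^n≢0 2 D}} {{m^n≢0 2 D}}}} (m≤m+n 9 7) ⟩
    16 * (z * z)              ≡⟨ trans (cong (16 *_) (sym (^-distribˡ-+-* 2 D D))) (sym (^-distribˡ-+-* 2 4 (D + D))) ⟩
    2 ^ f₀                     ∎
    where
    eq : ∀ z → z * (6 * z + (z + z)) ≡ 8 * (z * z)
    eq = solve-∀
  from-f₀ (suc x) = begin-strict
    D * (2 + suc (x + f₀))                ≡⟨ *-suc D (2 + (x + f₀)) ⟩
    D + D * (2 + (x + f₀))                <⟨ +-mono-≤-< (D≤2^ x) (from-f₀ x) ⟩
    2 ^ (x + f₀) + 2 ^ (x + f₀)            ≡⟨ cong (2 ^ (x + f₀) +_) (sym (+-identityʳ (2 ^ (x + f₀)))) ⟩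
    2 ^ (suc x + f₀)                      ∎

-- `bits n` is an integer ℓ above log₂ n, and `height ℓ` is the t used in `2^tri≤π`. `loss ℓ` equals
-- 1 + `bits ℓ`: the part `bits ℓ` pays for the factor t in t 2^t, and the 1 for rounding log₂ n up.
bits loss height : ℕ → ℕ
bits n = suc ⌊log₂ n ⌋
loss ℓ = 2 + ⌊log₂ ℓ ⌋
height ℓ = ℓ ∸ loss ℓ

n≤2^bits : ∀ n → n ≤ 2 ^ bits n
n≤2^bits n = <⇒≤ (n<2^1+⌊log₂n⌋ n)

height*2^height≤n : ∀ n .{{_ : NonZero n}} → height (bits n) * 2 ^ height (bits n) ≤ n
height*2^height≤n n with loss (bits n) ≤? bits n
-- For small n the truncated subtraction gives height 0, and t 2^t vanishes.
... | no  b≰ℓ = subst (λ t → t * 2 ^ t ≤ n) (sym (m≤n⇒m∸n≡0 (≰⇒≥ b≰ℓ))) z≤n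
... | yes b≤ℓ = begin
  t * 2 ^ t                     ≤⟨ *-monoˡ-≤ (2 ^ t) (≤-trans (m∸n≤m ℓ (loss ℓ)) (n≤2^bits ℓ)) ⟩
  2 ^ bits ℓ * 2 ^ t            ≡⟨ sym (^-distribˡ-+-* 2 (bits ℓ) t) ⟩
  2 ^ (bits ℓ + t)              ≡⟨ cong (2 ^_) (suc-injective (m+[n∸m]≡n b≤ℓ)) ⟩
  2 ^ ⌊log₂ n ⌋                 ≤⟨ 2^⌊log₂n⌋≤n n ⟩
  n                             ∎
  where
  open ≤-Reasoning
  ℓ = bits n
  t = height ℓ

2*tri : ∀ t → tri t + tri t ≡ t * suc t
2*tri zero    = refl
2*tri (suc t) = begin
  (suc t + tri t) + (suc t + tri t)    ≡⟨ shuffle (suc t) (tri t) ⟩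
  (tri t + tri t) + (suc t + suc t)    ≡⟨ cong (_+ (suc t + suc t)) (2*tri t) ⟩
  t * suc t + (suc t + suc t)          ≡⟨ collect t ⟩
  suc t * suc (suc t)                  ∎
  where
  open ≡-Reasoning
  shuffle : ∀ a b → (a + b) + (a + b) ≡ (b + b) + (a + a)
  shuffle = solve-∀
  collect : ∀ t → t * suc t + (suc t + suc t) ≡ suc t * suc (suc t)
  collect = solve-∀

-- The left side is t (t + 1), and t + 1 ≤ ℓ because `loss` is positive.
2*tri-height≤ : ∀ m → tri (height (suc m)) + tri (height (suc m)) ≤ suc m * suc m
2*tri-height≤ m = ≤-trans (≤-reflexive (2*tri (height (suc m))))
  (*-mono-≤ (m∸n≤m (suc m) (loss (suc m))) (s≤s (m∸n≤m m (suc ⌊log₂ suc m ⌋))))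

-- Substitute ℓ ≤ b + t for one factor at a time, then use t² ≤ t (t + 1) = 2 `tri t`. This bounds
-- how far tri t / ℓ² falls below ½.
ℓ²≤ : ∀ ℓ → ℓ * ℓ ≤ (tri (height ℓ) + tri (height ℓ)) + (ℓ * loss ℓ + ℓ * loss ℓ)
ℓ²≤ ℓ = begin
  ℓ * ℓ                            ≤⟨ *-monoʳ-≤ ℓ ℓ≤ ⟩
  ℓ * (b + t)                      ≡⟨ *-distribˡ-+ ℓ b t ⟩
  ℓ * b + ℓ * t                    ≤⟨ +-monoʳ-≤ (ℓ * b) (*-monoˡ-≤ t ℓ≤) ⟩
  ℓ * b + (b + t) * t              ≡⟨ cong (ℓ * b +_) (*-distribʳ-+ t b t) ⟩
  ℓ * b + (b * t + t * t)          ≤⟨ +-monoʳ-≤ (ℓ * b) (+-mono-≤ (≤-trans (*-monoʳ-≤ b (m∸n≤m ℓ b)) (≤-reflexive (*-comm b ℓ)))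
                                        (*-monoʳ-≤ t (n≤1+n t))) ⟩
  ℓ * b + (ℓ * b + t * suc t)      ≡⟨ cong (λ x → ℓ * b + (ℓ * b + x)) (sym (2*tri t)) ⟩
  ℓ * b + (ℓ * b + (tri t + tri t)) ≡⟨ trans (sym (+-assoc (ℓ * b) (ℓ * b) _)) (+-comm (ℓ * b + ℓ * b) _) ⟩
  (tri t + tri t) + (ℓ * b + ℓ * b) ∎
  where
  open ≤-Reasoning
  b = loss ℓ
  t = height ℓ
  ℓ≤ : ℓ ≤ b + t
  ℓ≤ = m≤n+m∸n ℓ b

-- For f = ⌊log₂ ℓ⌋ large, D (2 + f) < 2^f ≤ ℓ. The threshold is doubly exponential since f is an
-- iterated logarithm of n.
loss-sublinear : ∀ D → ∃ λ N → ∀ n → N ≤ n → D * loss (bits n) < bits n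
loss-sublinear D = let f₀ , dom = 2^-dominates-linear D in 2 ^ 2 ^ f₀ , λ n N≤n →
  let ℓ≥ : 2 ^ f₀ ≤ bits n
      ℓ≥ = m≤n⇒m≤1+n (subst (_≤ ⌊log₂ n ⌋) (⌊log₂[2^n]⌋≡n (2 ^ f₀)) (⌊log₂⌋-mono-≤ N≤n))
      f≥ : f₀ ≤ ⌊log₂ bits n ⌋
      f≥ = subst (_≤ ⌊log₂ bits n ⌋) (⌊log₂[2^n]⌋≡n f₀) (⌊log₂⌋-mono-≤ ℓ≥)
  in <-≤-trans (dom ⌊log₂ bits n ⌋ f≥) (2^⌊log₂n⌋≤n (bits n))

-- Natural numbers inside ℚ

ι-+ : ∀ m n → ι (m + n) ≡ ι m ℚ.+ ι n
ι-+ zero    n = trans (sym (ℚ.+-identityˡ (ι n))) (cong (ℚ._+ ι n) (sym ι-zero))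
ι-+ (suc m) n = begin
  ι (suc m + n)              ≡⟨ ι-suc (m + n) ⟩
  1ℚ ℚ.+ ι (m + n)           ≡⟨ cong (λ x → 1ℚ ℚ.+ x) (ι-+ m n) ⟩
  1ℚ ℚ.+ (ι m ℚ.+ ι n)       ≡⟨ sym (ℚ.+-assoc 1ℚ (ι m) (ι n)) ⟩
  (1ℚ ℚ.+ ι m) ℚ.+ ι n       ≡⟨ cong (ℚ._+ ι n) (sym (ι-suc m)) ⟩
  ι (suc m) ℚ.+ ι n          ∎
  where open ≡-Reasoning

ι-* : ∀ m n → ι (m * n) ≡ ι m ℚ.* ι n
ι-* zero    n = trans ι-zero (trans (sym (ℚ.*-zeroˡ (ι n))) (cong (ℚ._* ι n) (sym ι-zero)))
ι-* (suc m) n = begin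
  ι (n + m * n)                    ≡⟨ ι-+ n (m * n) ⟩
  ι n ℚ.+ ι (m * n)                ≡⟨ cong₂ ℚ._+_ (sym (ℚ.*-identityˡ (ι n))) (ι-* m n) ⟩
  1ℚ ℚ.* ι n ℚ.+ ι m ℚ.* ι n       ≡⟨ sym (ℚ.*-distribʳ-+ (ι n) 1ℚ (ι m)) ⟩
  (1ℚ ℚ.+ ι m) ℚ.* ι n             ≡⟨ cong (ℚ._* ι n) (sym (ι-suc m)) ⟩
  ι (suc m) ℚ.* ι n                ∎
  where open ≡-Reasoning

ι-^ : ∀ m n → ι (m ^ n) ≡ ι m ^ℚ n
ι-^ m zero    = trans (ι-suc 0) (trans (cong (λ x → 1ℚ ℚ.+ x) ι-zero) (ℚ.+-identityʳ 1ℚ))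
ι-^ m (suc n) = trans (ι-* m (m ^ n)) (cong (ι m ℚ.*_) (ι-^ m n))

ι-mono-≤ : ∀ {m n} → m ≤ n → ι m ℚ.≤ ι n
ι-mono-≤ {m} {n} m≤n = subst (ι m ℚ.≤_)
  (trans (sym (ι-+ m (n ∸ m))) (cong ι (m+[n∸m]≡n m≤n))) (p≤p+q (0≤ι (n ∸ m)))

ι-mono-< : ∀ {m n} → m < n → ι m ℚ.< ι n
ι-mono-< {m} m<n = ℚ.<-≤-trans (subst (ι m ℚ.<_) (trans (ℚ.+-comm (ι m) 1ℚ) (sym (ι-suc m))) (p<p+q 0<1))
  (ι-mono-≤ m<n)

1/ι : ∀ n .{{_ : NonZero n}} → ∃ λ u → 0ℚ ℚ.< u × ι n ℚ.* u ≡ 1ℚ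
1/ι n = 1/pos (subst (0ℚ ℚ.<_) (sym (ι≡fromℕ n)) (0<fromℕ n))

-- The function ε and its limit

-- ½ + ε(n), chosen as tri t / ℓ²: since log₂ n ≤ ℓ, the power n^(ratio n · log₂ n) is at most 2^tri t.
ratio : ℕ → ℚ
ratio n = ι (tri (height (bits n))) ℚ.* (u ℚ.* u)
  where u = proj₁ (1/ι (bits n))

0≤ratio : ∀ n → 0ℚ ℚ.≤ ratio n
0≤ratio n = let u , 0<u , _ = 1/ι (bits n) in
  *-nonNeg (0≤ι (tri (height (bits n)))) (ℚ.<⇒≤ (*-pos 0<u 0<u))

square-cancel : ∀ {x u} y → x ℚ.* u ≡ 1ℚ → y ℚ.* (u ℚ.* u) ℚ.* x ℚ.* x ≡ y
square-cancel {x} {u} y xu≡1 = begin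
  y ℚ.* (u ℚ.* u) ℚ.* x ℚ.* x        ≡⟨ solve 3 (λ x u y → y :* (u :* u) :* x :* x := y :* ((x :* u) :* (x :* u))) refl x u y ⟩
  y ℚ.* ((x ℚ.* u) ℚ.* (x ℚ.* u))    ≡⟨ cong (λ z → y ℚ.* (z ℚ.* z)) xu≡1 ⟩
  y ℚ.* 1ℚ                           ≡⟨ ℚ.*-identityʳ y ⟩
  y                                  ∎
  where
  open ≡-Reasoning
  open ℚ-Solver.+-*-Solver

ratio*bits² : ∀ n → ratio n ℚ.* ι (bits n) ℚ.* ι (bits n) ≡ ι (tri (height (bits n)))
ratio*bits² n = square-cancel (ι (tri (height (bits n)))) (proj₂ (proj₂ (1/ι (bits n))))

error : ∀ n → .{{NonZero n}} → ℝ
error n = fromℚ (ratio n ℚ.- ½)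

≤-halve : ∀ {p q} → p ℚ.+ p ℚ.≤ q ℚ.+ q → p ℚ.≤ q
≤-halve {p} {q} 2p≤2q = subst₂ ℚ._≤_ (eq p) (eq q) (Order.*-monoʳ-≤ (ℚ.nonNegative⁻¹ ½) 2p≤2q)
  where
  open ℚ-Solver.+-*-Solver
  eq : ∀ p → (p ℚ.+ p) ℚ.* ½ ≡ p
  eq p = trans (ℚ.*-distribʳ-+ ½ p p) (p½+p½≡p p)

<-halve : ∀ {p q} → p ℚ.+ p ℚ.< q ℚ.+ q → p ℚ.< q
<-halve {p} {q} 2p<2q with p ℚ.<? q
... | yes p<q = p<q
... | no  p≮q = contradiction (ℚ.<-≤-trans 2p<2q (ℚ.+-mono-≤ (ℚ.≮⇒≥ p≮q) (ℚ.≮⇒≥ p≮q))) (ℚ.<-irrefl refl)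

-- Divide `2*tri-height≤` by ℓ², with u standing for 1/ℓ. So ε(n) is never positive, and only the
-- lower side of the convergence needs large n.
ratio≤½ : ∀ n → ratio n ℚ.≤ ½
ratio≤½ n = ≤-halve (begin
  Y ℚ.* (u ℚ.* u) ℚ.+ Y ℚ.* (u ℚ.* u)  ≡⟨ sym (ℚ.*-distribʳ-+ (u ℚ.* u) Y Y) ⟩
  (Y ℚ.+ Y) ℚ.* (u ℚ.* u)              ≤⟨ Order.*-monoʳ-≤ (ℚ.<⇒≤ (*-pos 0<u 0<u)) 2Y≤X² ⟩
  (X ℚ.* X) ℚ.* (u ℚ.* u)              ≡⟨ solve 2 (λ x u → (x :* x) :* (u :* u) := (x :* u) :* (x :* u)) refl X u ⟩
  (X ℚ.* u) ℚ.* (X ℚ.* u)              ≡⟨ cong (λ z → z ℚ.* z) Xu≡1 ⟩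
  1ℚ                                   ∎)
  where
  open ≤R
  open ℚ-Solver.+-*-Solver
  X = ι (bits n)
  Y = ι (tri (height (bits n)))
  u = proj₁ (1/ι (bits n))
  0<u = proj₁ (proj₂ (1/ι (bits n)))
  Xu≡1 = proj₂ (proj₂ (1/ι (bits n)))
  2Y≤X² : Y ℚ.+ Y ℚ.≤ X ℚ.* X
  2Y≤X² = subst₂ ℚ._≤_ (ι-+ (tri (height (bits n))) (tri (height (bits n)))) (ι-* (bits n) (bits n))
    (ι-mono-≤ (2*tri-height≤ ⌊log₂ n ⌋))

-- Dividing `ℓ²≤` by ℓ² gives 1 ≤ 2 `ratio n` + 2b/ℓ with b the loss, and b/ℓ < 1/D ≤ q.
½<ratio+q : ∀ {q} D → 1ℚ ℚ.≤ ι D ℚ.* q → 0ℚ ℚ.< q → ∀ n → D * loss (bits n) < bits n →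
  ½ ℚ.< ratio n ℚ.+ q
½<ratio+q {q} D 1≤Dq 0<q n Db<ℓ = <-halve (begin-strict
  1ℚ                                     ≡⟨ cong (λ z → z ℚ.* z) (sym Xu≡1) ⟩
  (X ℚ.* u) ℚ.* (X ℚ.* u)                ≡⟨ solve 2 (λ x u → (x :* u) :* (x :* u) := (x :* x) :* (u :* u)) refl X u ⟩
  (X ℚ.* X) ℚ.* (u ℚ.* u)                ≤⟨ Order.*-monoʳ-≤ (ℚ.<⇒≤ 0<u²) X²≤ ⟩
  ((Y ℚ.+ Y) ℚ.+ (X ℚ.* B ℚ.+ X ℚ.* B)) ℚ.* (u ℚ.* u)
                                         <⟨ Order.*-monoʳ-< 0<u² (ℚ.+-monoʳ-< (Y ℚ.+ Y) (ℚ.+-mono-< XB<XXq XB<XXq)) ⟩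
  ((Y ℚ.+ Y) ℚ.+ (X ℚ.* (X ℚ.* q) ℚ.+ X ℚ.* (X ℚ.* q))) ℚ.* (u ℚ.* u)
                                         ≡⟨ solve 4 (λ x y u q → ((y :+ y) :+ (x :* (x :* q) :+ x :* (x :* q))) :* (u :* u)
                                              := (y :* (u :* u) :+ ((x :* u) :* (x :* u)) :* q) :+ (y :* (u :* u) :+ ((x :* u) :* (x :* u)) :* q))
                                              refl X Y u q ⟩
  (ρ ℚ.+ ((X ℚ.* u) ℚ.* (X ℚ.* u)) ℚ.* q) ℚ.+ (ρ ℚ.+ ((X ℚ.* u) ℚ.* (X ℚ.* u)) ℚ.* q)
                                         ≡⟨ cong (λ z → (ρ ℚ.+ (z ℚ.* z) ℚ.* q) ℚ.+ (ρ ℚ.+ (z ℚ.* z) ℚ.* q)) Xu≡1 ⟩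
  (ρ ℚ.+ 1ℚ ℚ.* q) ℚ.+ (ρ ℚ.+ 1ℚ ℚ.* q)  ≡⟨ cong (λ z → (ρ ℚ.+ z) ℚ.+ (ρ ℚ.+ z)) (ℚ.*-identityˡ q) ⟩
  (ρ ℚ.+ q) ℚ.+ (ρ ℚ.+ q)                ∎)
  where
  open ≤R
  open ℚ-Solver.+-*-Solver
  ℓ = bits n
  S = tri (height ℓ)
  b = loss ℓ
  X = ι ℓ
  Y = ι S
  B = ι b
  ρ = ratio n
  u = proj₁ (1/ι ℓ)
  0<u = proj₁ (proj₂ (1/ι ℓ))
  Xu≡1 = proj₂ (proj₂ (1/ι ℓ))
  0<u² = *-pos 0<u 0<u
  X²≤ : X ℚ.* X ℚ.≤ (Y ℚ.+ Y) ℚ.+ (X ℚ.* B ℚ.+ X ℚ.* B)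
  X²≤ = subst₂ ℚ._≤_ (ι-* ℓ ℓ)
    (trans (ι-+ (S + S) (ℓ * b + ℓ * b)) (cong₂ ℚ._+_ (ι-+ S S)
      (trans (ι-+ (ℓ * b) (ℓ * b)) (cong₂ ℚ._+_ (ι-* ℓ b) (ι-* ℓ b)))))
    (ι-mono-≤ (ℓ²≤ ℓ))
  0<X : 0ℚ ℚ.< X
  0<X = subst (0ℚ ℚ.<_) (sym (ι≡fromℕ ℓ)) (0<fromℕ ℓ)
  B<Xq : B ℚ.< X ℚ.* q
  B<Xq = begin-strict
    B                   ≡⟨ sym (ℚ.*-identityˡ B) ⟩
    1ℚ ℚ.* B            ≤⟨ Order.*-monoʳ-≤ (0≤ι b) 1≤Dq ⟩
    (ι D ℚ.* q) ℚ.* B   ≡⟨ solve 3 (λ d q b → (d :* q) :* b := (d :* b) :* q) refl (ι D) q B ⟩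
    (ι D ℚ.* B) ℚ.* q   ≡⟨ cong (ℚ._* q) (sym (ι-* D b)) ⟩
    ι (D * b) ℚ.* q     <⟨ Order.*-monoʳ-< 0<q (ι-mono-< Db<ℓ) ⟩
    X ℚ.* q             ∎
  XB<XXq : X ℚ.* B ℚ.< X ℚ.* (X ℚ.* q)
  XB<XXq = subst₂ ℚ._<_ (ℚ.*-comm B X) (ℚ.*-comm (X ℚ.* q) X) (Order.*-monoʳ-< 0<X B<Xq)

error→0 : TendsToZero error
error→0 δ (q , 0<q , q<δ) =
  let D , 1≤Dq = archimedean 0<q 1ℚ
      N , small = loss-sublinear D
  in N , λ n N≤n →
    -- The rational q between 0 and δ separates ε(n) from δ, and `ℚ.- q` separates it from -δ.
    (ℚ.- q , subst (L δ) (sym (neg-neg q)) q<δ , -q<error (ratio n) (½<ratio+q D 1≤Dq 0<q n (small n N≤n))) ,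
    (q , ℚ.≤-<-trans (error≤0 (ratio n) (ratio≤½ n)) 0<q , q<δ)
  where
  open ℚ-Solver.+-*-Solver
  -q<error : ∀ ρ → ½ ℚ.< ρ ℚ.+ q → ℚ.- q ℚ.< ρ ℚ.- ½
  -q<error ρ ½<ρ+q = subst₂ ℚ._<_
    (solve 2 (λ q h → h :+ (:- q :- h) := :- q) refl q ½)
    (solve 3 (λ q h ρ → (ρ :+ q) :+ (:- q :- h) := ρ :- h) refl q ½ ρ)
    (ℚ.+-monoˡ-< (ℚ.- q ℚ.- ½) ½<ρ+q)
  error≤0 : ∀ ρ → ρ ℚ.≤ ½ → ρ ℚ.- ½ ℚ.≤ 0ℚ
  error≤0 ρ ρ≤½ = subst (ρ ℚ.- ½ ℚ.≤_) (ℚ.+-inverseʳ ½) (ℚ.+-monoˡ-≤ (ℚ.- ½) ρ≤½)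

-- Passage to real powers

-- The cut `log₂` reads numerators and denominators, which the opaque `ι` hides and `integral`
-- exposes.
ι≡integral : ∀ n → ι n ≡ integral (ℤ.+ n)
ι≡integral n = trans (ι≡fromℕ n) (ℚ.↥p/↧p≡p (integral (ℤ.+ n)))

-- If `ι ℓ` were below c, then ℓ would witness c in the upper cut, since n ≤ 2^ℓ, against
-- disjointness.
log₂≤ : ∀ n .{{_ : NonZero n}} ℓ → n ≤ 2 ^ ℓ → ∀ {c} → L (log₂ n) c → c ℚ.≤ ι ℓ
log₂≤ n ℓ n≤2^ℓ {c} lc with c ℚ.≤? ι ℓ
... | yes c≤ℓ = c≤ℓ
... | no  c≰ℓ = contradiction
  (integral (ℤ.+ ℓ) , subst (ℚ._< c) (ι≡integral ℓ) (ℚ.≰⇒> c≰ℓ) , subst₂ ℚ._≤_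
    (trans (ι≡fromℕ n) (sym (ℚ.*-identityʳ (fromℕ n))))
    (trans (ι-^ 2 ℓ) (cong (_^ℚ ℓ) (ι≡fromℕ 2)))
    (ι-mono-≤ n≤2^ℓ))
  (disjoint (log₂ n) lc)

-- Rational exponents occur in `_^ᴿ_` as separate powers by numerator and denominator, so bounds on
-- r are needed with the denominator cleared.
cross-multiply : ∀ r ℓ S → r ℚ.* ι ℓ ℚ.≤ ι S → ↥ r ℤ.* ℤ.+ ℓ ℤ.≤ ℤ.+ (S * ↧ₙ r)
cross-multiply r@(mkℚ a d _) ℓ S rℓ≤S = subst₂ ℤ._≤_
  (ℤ.*-identityʳ (a ℤ.* ℤ.+ ℓ))
  (trans (cong (λ x → ℤ.+ S ℤ.* ℤ.+ x) (*-identityʳ (suc d))) (sym (ℤ.pos-* S (suc d))))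
  (ℚᵘ.drop-*≤* (begin
    toℚᵘ r ℚᵘ.* (ℤ.+ ℓ ℚᵘ./ 1)    ≃⟨ ℚᵘ.*-congˡ {toℚᵘ r} (ℚᵘ.≃-sym (toℚᵘ-/ (ℤ.+ ℓ) 1)) ⟩
    toℚᵘ r ℚᵘ.* toℚᵘ (fromℕ ℓ)    ≃⟨ ℚᵘ.≃-sym (ℚ.toℚᵘ-homo-* r (fromℕ ℓ)) ⟩
    toℚᵘ (r ℚ.* fromℕ ℓ)          ≤⟨ ℚ.toℚᵘ-mono-≤ (subst₂ (λ x y → r ℚ.* x ℚ.≤ y) (ι≡fromℕ ℓ) (ι≡fromℕ S) rℓ≤S) ⟩
    toℚᵘ (fromℕ S)                ≃⟨ toℚᵘ-/ (ℤ.+ S) 1 ⟩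
    (ℤ.+ S ℚᵘ./ 1)                ∎))
  where open ℚᵘ.≤-Reasoning

-- For r = m / D with m ≥ 0, n^m ≤ 2^(ℓ m) ≤ 2^(S D).
^ᶻ≤ : ∀ n .{{_ : NonZero n}} ℓ S r → n ≤ 2 ^ ℓ → r ℚ.* ι ℓ ℚ.≤ ι S →
  n ^ᶻ ↥ r ℚ.≤ ι (2 ^ S) ^ℚ ↧ₙ r
^ᶻ≤ n ℓ S r@(mkℚ (ℤ.+ m) d _) n≤2^ℓ rℓ≤S = begin
  fromℕ n ^ℚ m             ≡⟨ cong (_^ℚ m) (sym (ι≡fromℕ n)) ⟩
  ι n ^ℚ m                 ≤⟨ ^-mono-≤ m (0≤ι n) (ι-mono-≤ n≤2^ℓ) ⟩
  ι (2 ^ ℓ) ^ℚ m           ≡⟨ trans (sym (ι-^ (2 ^ ℓ) m)) (cong ι (^-*-assoc 2 ℓ m)) ⟩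
  ι (2 ^ (ℓ * m))          ≤⟨ ι-mono-≤ (^-monoʳ-≤ 2 ℓm≤SD) ⟩
  ι (2 ^ (S * suc d))      ≡⟨ trans (cong ι (sym (^-*-assoc 2 S (suc d)))) (ι-^ (2 ^ S) (suc d)) ⟩
  ι (2 ^ S) ^ℚ suc d       ∎
  where
  open ≤R
  ℓm≤SD : ℓ * m ≤ S * suc d
  ℓm≤SD = ℤ.drop‿+≤+ (subst (ℤ._≤ ℤ.+ (S * suc d))
    (trans (sym (ℤ.pos-* m ℓ)) (cong ℤ.+_ (*-comm m ℓ))) (cross-multiply r ℓ S rℓ≤S))
-- A negative exponent makes the left side at most 1, as n ≥ 1.
^ᶻ≤ n ℓ S r@(mkℚ -[1+ m ] d _) n≤2^ℓ rℓ≤S = begin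
  n ^ᶻ -[1+ m ]            ≤⟨ ^ℤ-mono-≤ (fromℕ n) {{fromℕ-nonZero n}} (1≤fromℕ n) (ℤ.-≤+ {m} {0}) ⟩
  1ℚ                       ≡⟨ sym (ι-^ 2 0) ⟩
  ι 1                      ≤⟨ ι-mono-≤ (m^n>0 (2 ^ S) {{m^n≢0 2 S}} (suc d)) ⟩
  ι ((2 ^ S) ^ suc d)      ≡⟨ ι-^ (2 ^ S) (suc d) ⟩
  ι (2 ^ S) ^ℚ suc d       ∎
  where open ≤R

-- A rational q in the lower cut of the power comes with r below ρ log₂ n and some w > q with w ≤
-- n^r. Then r < ρ c ≤ ρ ℓ for some c below log₂ n, hence r ℓ ≤ ρ ℓ² = S, and taking roots gives w ≤
-- 2^S.
power≤ : ∀ n .{{_ : NonZero n}} ρ ℓ S p → 0ℚ ℚ.≤ ρ → n ≤ 2 ^ ℓ → ρ ℚ.* ι ℓ ℚ.* ι ℓ ≡ ι S →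
  2 ^ S ≤ p → n ^ᴿ ((fromℚ ½ +ᴿ fromℚ (ρ ℚ.- ½)) *ᴿ log₂ n) ≤ᴿ fromℚ (fromℕ p)
power≤ n ρ ℓ S p 0≤ρ n≤2^ℓ ρℓ²≡S 2^S≤p {q}
  (r , w , (a , b , c , d , (a₁ , a₂ , a₁<½ , a₂<e , a<) , (b₁ , b₂ , ½<b₁ , e<b₂ , <b) , lc , ud , r<)
  , q<w , 0≤w , w^D≤) =
  ℚ.<-≤-trans q<w (begin
    w            ≤⟨ ^-cancel-≤ (↧ₙ r) (0≤ι (2 ^ S)) (ℚ.≤-trans w^D≤ (^ᶻ≤ n ℓ S r n≤2^ℓ rℓ≤S)) ⟩
    ι (2 ^ S)    ≤⟨ ι-mono-≤ 2^S≤p ⟩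
    ι p          ≡⟨ ι≡fromℕ p ⟩
    fromℕ p      ∎)
  where
  open ≤R
  ½+e≡ρ : ½ ℚ.+ (ρ ℚ.- ½) ≡ ρ
  ½+e≡ρ = p+[q-p]≡q ½ ρ
  a≤ρ : a ℚ.≤ ρ
  a≤ρ = ℚ.<⇒≤ (subst (a ℚ.<_) ½+e≡ρ (ℚ.<-trans a< (ℚ.+-mono-< a₁<½ a₂<e)))
  ρ≤b : ρ ℚ.≤ b
  ρ≤b = ℚ.<⇒≤ (subst (ℚ._< b) ½+e≡ρ (ℚ.<-trans (ℚ.+-mono-< ½<b₁ e<b₂) <b))
  -- The least corner product bounds the product at (ρ , c), a point of the rectangle with sides
  -- [a , b] and [c , d].
  r<ρc : r ℚ.< ρ ℚ.* c
  r<ρc = minProduct-≤ a≤ρ ρ≤b ℚ.≤-refl (ℚ.<⇒≤ (L<U (log₂ n) lc ud)) r<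
  rℓ≤S : r ℚ.* ι ℓ ℚ.≤ ι S
  rℓ≤S = subst (r ℚ.* ι ℓ ℚ.≤_) ρℓ²≡S (Order.*-monoʳ-≤ (0≤ι ℓ)
    (ℚ.≤-trans (ℚ.<⇒≤ r<ρc) (Order.*-monoˡ-≤ 0≤ρ (log₂≤ n ℓ n≤2^ℓ lc))))

theorem1p5 : (∃ λ (ε : ∀ n → .{{_ : NonZero n}} → ℝ) →
    TendsToZero ε
    × (∀ n .{{_ : NonZero n}} (G : Graph n) →
    n ^ᴿ ((fromℚ ½ +ᴿ ε n) *ᴿ log₂ n) ≤ᴿ fromℚ (fromℕ (π G))
    × π G ≤ (n + 1) * 2 ^ n))
    × (∀ n .{{_ : NonZero n}} →
    π (K n) ≡ (n + 1) * 2 ^ n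
    × π (E n) ≡ (n + 1) * 2 ^ n)
theorem1p5 =
  (error , error→0 , λ n G → bound n G , π≤ G) , λ n → π-K n , π-E n
  where
  bound : ∀ n .{{_ : NonZero n}} (G : Graph n) →
    n ^ᴿ ((fromℚ ½ +ᴿ error n) *ᴿ log₂ n) ≤ᴿ fromℚ (fromℕ (π G))
  bound n G = power≤ n (ratio n) (bits n) (tri t) (π G) (0≤ratio n) (n≤2^bits n)
    (ratio*bits² n) (2^tri≤π t G (height*2^height≤n n))
    where t = height (bits n)
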